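{- Given a proof net ρ, there exists a derivation π in MLL^{0,2}_{hyp} such that ρ is isomorphic to D(π); such a π is called a sequentialization of ρ.
   Context: MLL^{0,2}_{hyp} is the sequent calculus of unit-free multiplicative linear logic (formulas built from atoms X, X^⊥ with ⊗ and ⅋) with rules: ax (⊢ A^⊥, A), cut, ⊗, ⅋, mix_2 (from ⊢ Γ and ⊢ Δ derive ⊢ Γ, Δ), mix_0 (⊢ with empty sequent), and hyp (⊢ A for any single formula A, an open hypothesis). A proof structure is a directed acyclic partial graph (each edge has an optional source and an optional target) whose vertices are labeled ax, cut, ⊗ or ⅋: each ax-vertex has two conclusions and no premise, each cut-vertex has two premises and no conclusion, each ⊗-vertex and each ⅋-vertex has two premises and one conclusion; edges are labeled by formulas subject to the usual typing constraints; edges with no source (resp. no target) are the premises (resp. conclusions) of the structure. Paths are taken in the underlying undirected partial graph; a cycle is a non-empty simple closed path; a path is switching when it does not contain both premises of any ⅋-vertex; a proof net is a proof structure with no switching cycle. The desequentialization D(π) is defined by induction on π: an ax rule gives a single ax-vertex with its two conclusions; cut, ⊗, ⅋ rules add a cut-, ⊗- or ⅋-vertex on the edges of the principal formulas of the translated sub-derivations (with a new conclusion edge for ⊗ and ⅋); mix_2 is the disjoint union of the translations; mix_0 gives the empty graph; hyp on ⊢ A gives a single edge labeled A with no endpoint. -}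

module Defs where

open import Data.Nat using (ℕ)
open import Data.Bool using (Bool; true; false)
open import Data.Unit using (⊤; tt)
open import Data.Empty using (⊥)
open import Data.Sum using (_⊎_; inj₁; inj₂)
open import Data.Product using (_×_; _,_; proj₁; proj₂; Σ; ∃; ∃-syntax)
open import Data.List using (List; []; _∷_; _++_; _∷ʳ_; [_])
open import Data.List.Relation.Unary.All using (All; []; _∷_)
import Data.List.Relation.Unary.All.Properties as AllP
open import Data.List.Membership.Propositional using (_∈_)
open import Data.List.Relation.Unary.Unique.Propositional using (Unique)
open import Data.List.Relation.Binary.Permutation.Propositional using (_↭_)
open import Data.List.Relation.Binary.Permutation.Propositional.Properties using (All-resp-↭)
open import Relation.Binary.Construct.Closure.Transitive using (TransClosure)
open import Relation.Binary.PropositionalEquality using (_≡_)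
open import Relation.Nullary using (¬_)
open import Function.Bundles using (_↔_; Inverse)

infixr 6 _⊗_ _⅋_

data Formula : Set where
  pos : ℕ → Formula
  neg : ℕ → Formula
  _⊗_ : Formula → Formula → Formula
  _⅋_ : Formula → Formula → Formula

_^⊥ : Formula → Formula
pos x ^⊥ = neg x
neg x ^⊥ = pos x
(A ⊗ B) ^⊥ = (A ^⊥) ⅋ (B ^⊥)
(A ⅋ B) ^⊥ = (A ^⊥) ⊗ (B ^⊥)

-- Sequent calculus MLL^{0,2}_hyp.  Sequents are lists of formulas,
-- read up to permutation (explicit structural exchange rule `ex`);
-- principal formulas are placed at the end of the premise sequents.

data Deriv : List Formula → Set where
  ax   : (A : Formula) → Deriv ((A ^⊥) ∷ A ∷ [])
  cut  : ∀ {Γ Δ A} → Deriv (Γ ∷ʳ A) → Deriv (Δ ∷ʳ (A ^⊥)) → Deriv (Γ ++ Δ)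
  tens : ∀ {Γ Δ A B} → Deriv (Γ ∷ʳ A) → Deriv (Δ ∷ʳ B) → Deriv ((Γ ++ Δ) ∷ʳ (A ⊗ B))
  par  : ∀ {Γ A B} → Deriv ((Γ ∷ʳ A) ∷ʳ B) → Deriv (Γ ∷ʳ (A ⅋ B))
  mix2 : ∀ {Γ Δ} → Deriv Γ → Deriv Δ → Deriv (Γ ++ Δ)
  mix0 : Deriv []
  hyp  : (A : Formula) → Deriv (A ∷ [])
  ex   : ∀ {Γ Δ} → Γ ↭ Δ → Deriv Γ → Deriv Δ

-- (Raw) structures: vertices V, edges E.  A vertex records which edges
-- are attached to its ports; the source/target of an edge is the vertex
-- having it as a conclusion/premise (if any).

data Node (E : Set) : Set where
  axN   : (c₁ c₂ : E) → Node E
  cutN  : (p₁ p₂ : E) → Node E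
  tensN : (l r c : E) → Node E
  parN  : (l r c : E) → Node E

concs : ∀ {E} → Node E → List E
concs (axN a b)     = a ∷ b ∷ []
concs (cutN _ _)    = []
concs (tensN _ _ c) = c ∷ []
concs (parN _ _ c)  = c ∷ []

prems : ∀ {E} → Node E → List E
prems (axN _ _)     = []
prems (cutN a b)    = a ∷ b ∷ []
prems (tensN l r _) = l ∷ r ∷ []
prems (parN l r _)  = l ∷ r ∷ []

mapNode : ∀ {E E′} → (E → E′) → Node E → Node E′
mapNode f (axN a b)     = axN (f a) (f b)
mapNode f (cutN a b)    = cutN (f a) (f b)
mapNode f (tensN l r c) = tensN (f l) (f r) (f c)
mapNode f (parN l r c)  = parN (f l) (f r) (f c)

record Struct (V E : Set) : Set where
  field
    node : V → Node E
    form : E → Formula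
open Struct public

module _ {V E : Set} (S : Struct V E) where

  WellTyped : Node E → Set
  WellTyped (axN a b)     = form S a ≡ (form S b) ^⊥
  WellTyped (cutN a b)    = form S b ≡ (form S a) ^⊥
  WellTyped (tensN l r c) = form S c ≡ form S l ⊗ form S r
  WellTyped (parN l r c)  = form S c ≡ form S l ⅋ form S r

  Arc : V → V → Set
  Arc v w = ∃[ e ] (e ∈ concs (node S v) × e ∈ prems (node S w))

  record IsProofStructure : Set where
    field
      typed      : ∀ v → WellTyped (node S v)
      portsDistinct : ∀ v → Unique (concs (node S v) ++ prems (node S v))
      uniqueSrc  : ∀ v w e → e ∈ concs (node S v) → e ∈ concs (node S w) → v ≡ w
      uniqueTgt  : ∀ v w e → e ∈ prems (node S v) → e ∈ prems (node S w) → v ≡ w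
      acyclic    : ∀ v → ¬ TransClosure Arc v v

  Link : E → V → V → Set
  Link e v w = (e ∈ concs (node S v) × e ∈ prems (node S w))
             ⊎ (e ∈ prems (node S v) × e ∈ concs (node S w))

  -- undirected path from v to w, listing its edges and the vertices
  -- it passes through (all but the final endpoint)
  data Path : V → V → List E → List V → Set where
    []  : ∀ {v} → Path v v [] []
    _∷_ : ∀ {v u w e es vs} → Link e v u → Path u w es vs → Path v w (e ∷ es) (v ∷ vs)

  Switching : List E → Set
  Switching es = ∀ v l r c → node S v ≡ parN l r c → ¬ (l ∈ es × r ∈ es)

  record SwitchingCycle : Set where
    field
      base  : V
      edges : List E
      verts : List V
      path  : Path base base edges verts
      nonEmpty : ¬ (edges ≡ [])
      simpleE  : Unique edges
      simpleV  : Unique verts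
      switching : Switching edges

  record IsProofNet : Set where
    field
      isPS : IsProofStructure
      noSwitchingCycle : ¬ SwitchingCycle

record _≅_ {V E V′ E′ : Set} (S : Struct V E) (S′ : Struct V′ E′) : Set where
  field
    vIso : V ↔ V′
    eIso : E ↔ E′
    nodeHom : ∀ v → node S′ (Inverse.to vIso v) ≡ mapNode (Inverse.to eIso) (node S v)
    formHom : ∀ e → form S′ (Inverse.to eIso e) ≡ form S e

-- Desequentialization D(π): vertex set DV π, edge set DE π, the structure
-- DS π, and the conclusion edges Dc π (one per formula of the sequent).

DV : ∀ {Γ} → Deriv Γ → Set
DE : ∀ {Γ} → Deriv Γ → Set
DV (ax A)       = ⊤
DV (cut π₁ π₂)  = (DV π₁ ⊎ DV π₂) ⊎ ⊤
DV (tens π₁ π₂) = (DV π₁ ⊎ DV π₂) ⊎ ⊤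
DV (par π)      = DV π ⊎ ⊤
DV (mix2 π₁ π₂) = DV π₁ ⊎ DV π₂
DV mix0         = ⊥
DV (hyp A)      = ⊥
DV (ex σ π)     = DV π
DE (ax A)       = Bool
DE (cut π₁ π₂)  = DE π₁ ⊎ DE π₂
DE (tens π₁ π₂) = (DE π₁ ⊎ DE π₂) ⊎ ⊤
DE (par π)      = DE π ⊎ ⊤
DE (mix2 π₁ π₂) = DE π₁ ⊎ DE π₂
DE mix0         = ⊥
DE (hyp A)      = ⊤
DE (ex σ π)     = DE π

Cs : Set → List Formula → Set
Cs E Γ = All (λ _ → E) Γ

mapC : ∀ {E E′ Γ} → (E → E′) → Cs E Γ → Cs E′ Γ
mapC f []       = []
mapC f (e ∷ es) = f e ∷ mapC f es

initC : ∀ {E} Γ {A} → Cs E (Γ ∷ʳ A) → Cs E Γ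
initC []      _        = []
initC (_ ∷ Γ) (e ∷ es) = e ∷ initC Γ es

lastC : ∀ {E} Γ {A} → Cs E (Γ ∷ʳ A) → E
lastC []      (e ∷ _)  = e
lastC (_ ∷ Γ) (_ ∷ es) = lastC Γ es

Dc : ∀ {Γ} (π : Deriv Γ) → Cs (DE π) Γ
Dc (ax A) = false ∷ true ∷ []
Dc (cut {Γ} {Δ} π₁ π₂) =
  AllP.++⁺ (mapC inj₁ (initC Γ (Dc π₁))) (mapC inj₂ (initC Δ (Dc π₂)))
Dc (tens {Γ} {Δ} π₁ π₂) =
  AllP.++⁺ (AllP.++⁺ (mapC (λ e → inj₁ (inj₁ e)) (initC Γ (Dc π₁)))
                     (mapC (λ e → inj₁ (inj₂ e)) (initC Δ (Dc π₂))))
           (inj₂ tt ∷ [])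
Dc (par {Γ} {A} π) =
  AllP.++⁺ (mapC inj₁ (initC Γ (initC (Γ ∷ʳ A) (Dc π)))) (inj₂ tt ∷ [])
Dc (mix2 π₁ π₂) = AllP.++⁺ (mapC inj₁ (Dc π₁)) (mapC inj₂ (Dc π₂))
Dc mix0 = []
Dc (hyp A) = tt ∷ []
Dc (ex σ π) = All-resp-↭ σ (Dc π)

DS : ∀ {Γ} (π : Deriv Γ) → Struct (DV π) (DE π)
node (DS (ax A)) tt = axN false true
form (DS (ax A)) false = A ^⊥
form (DS (ax A)) true  = A
node (DS (cut π₁ π₂)) (inj₁ (inj₁ v)) = mapNode inj₁ (node (DS π₁) v)
node (DS (cut π₁ π₂)) (inj₁ (inj₂ v)) = mapNode inj₂ (node (DS π₂) v)
node (DS (cut {Γ} {Δ} π₁ π₂)) (inj₂ tt) =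
  cutN (inj₁ (lastC Γ (Dc π₁))) (inj₂ (lastC Δ (Dc π₂)))
form (DS (cut π₁ π₂)) (inj₁ e) = form (DS π₁) e
form (DS (cut π₁ π₂)) (inj₂ e) = form (DS π₂) e
node (DS (tens π₁ π₂)) (inj₁ (inj₁ v)) = mapNode (λ e → inj₁ (inj₁ e)) (node (DS π₁) v)
node (DS (tens π₁ π₂)) (inj₁ (inj₂ v)) = mapNode (λ e → inj₁ (inj₂ e)) (node (DS π₂) v)
node (DS (tens {Γ} {Δ} π₁ π₂)) (inj₂ tt) =
  tensN (inj₁ (inj₁ (lastC Γ (Dc π₁)))) (inj₁ (inj₂ (lastC Δ (Dc π₂)))) (inj₂ tt)
form (DS (tens π₁ π₂)) (inj₁ (inj₁ e)) = form (DS π₁) e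
form (DS (tens π₁ π₂)) (inj₁ (inj₂ e)) = form (DS π₂) e
form (DS (tens {A = A} {B = B} π₁ π₂)) (inj₂ tt) = A ⊗ B
node (DS (par π)) (inj₁ v) = mapNode inj₁ (node (DS π) v)
node (DS (par {Γ} {A} π)) (inj₂ tt) =
  parN (inj₁ (lastC Γ (initC (Γ ∷ʳ A) (Dc π)))) (inj₁ (lastC (Γ ∷ʳ A) (Dc π))) (inj₂ tt)
form (DS (par π)) (inj₁ e) = form (DS π) e
form (DS (par {A = A} {B = B} π)) (inj₂ tt) = A ⅋ B
node (DS (mix2 π₁ π₂)) (inj₁ v) = mapNode inj₁ (node (DS π₁) v)
node (DS (mix2 π₁ π₂)) (inj₂ v) = mapNode inj₂ (node (DS π₂) v)
form (DS (mix2 π₁ π₂)) (inj₁ e) = form (DS π₁) e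
form (DS (mix2 π₁ π₂)) (inj₂ e) = form (DS π₂) e
node (DS mix0) ()
form (DS mix0) ()
node (DS (hyp A)) ()
form (DS (hyp A)) tt = A
DS (ex σ π) = DS π

{-# OPTIONS --safe #-}
module Submission where

-- Only the existence of a terminal vertex that splits the net matters; the derivation is then
-- built by induction on sub-nets of ρ, each given by a set of vertices and a set of edges.
-- Call a path cusp-free if it never crosses a ⅋-vertex from one premise to the other.  For
-- ⅋-vertices put v ◁ u when a cusp-free simple path goes from v, through its conclusion, to a
-- premise of u, and no cusp-free simple path leaving u through its conclusion meets it again.
-- This is a strict order.  If the conclusion of v lies on a cycle, then minimising the cusps of
-- that cycle yields a switching cycle or some u with v ◁ u; so the conclusion of a ◁-maximal
-- ⅋-vertex is a bridge (or has no target), and one concludes by induction on the part below it.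
-- Without ⅋-vertices the same argument shows that every terminal vertex splits.  The choice is
-- classical, but splitting is decidable, so a refutation of its absence gives a witness.

open import Defs
open import Data.Bool using (true; false)
open import Data.Empty using (⊥; ⊥-elim)
open import Data.Fin using (Fin; zero; suc; _≟_)
open import Data.Fin.Induction using (spo-noetherian)
open import Data.Fin.Properties using (any?; all?)
open import Data.Fin.Subset using (Subset; Nonempty; _⊂_) renaming (_∈_ to _∈ˢ_; _∉_ to _∉ˢ_; ⊥ to ∅; ⊤ to full)
open import Data.Fin.Subset.Induction using (⊂-wellFounded)
open import Data.Fin.Subset.Properties using (∉⊥; ∈⊤; anySubset?; nonempty?) renaming (_∈?_ to _∈ˢ?_)
open import Data.List using (List; []; _∷_; _++_; _∷ʳ_; [_])
open import Data.List.Membership.Propositional using (_∈_; _∉_)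
open import Data.List.Membership.Propositional.Properties using (∈-++⁺ˡ; ∈-++⁺ʳ; ∈-++⁻)
open import Data.List.Relation.Binary.Disjoint.Propositional using (Disjoint)
open import Data.List.Relation.Binary.Permutation.Propositional using (_↭_; prep; swap; ↭-sym; ↭-trans; ↭-refl; ↭⇒↭ₛ) renaming (refl to refl↭; trans to trans↭)
open import Data.List.Relation.Binary.Permutation.Propositional.Properties using (∷↭∷ʳ; ∈-resp-↭; shift; All-resp-↭)
open import Data.List.Relation.Unary.All as All using ([]; _∷_)
open import Data.List.Relation.Unary.AllPairs using ([]; _∷_)
open import Data.List.Relation.Unary.Any using (here; there)
open import Data.List.Relation.Unary.Unique.Propositional using (Unique)
open import Data.List.Relation.Unary.Unique.Propositional.Properties using (++⁺)
open import Data.Nat using (ℕ; zero; suc)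
open import Data.Product using (Σ; ∃; ∃-syntax; _×_; _,_; proj₁; proj₂)
open import Data.Sum using (_⊎_; inj₁; inj₂; [_,_]′)
open import Data.Unit using (⊤; tt)
open import Data.Vec using (tabulate)
open import Data.Vec.Properties using (lookup∘tabulate; []=⇒lookup; lookup⇒[]=)
open import Function using (_∘_; flip; id; mk↔ₛ′)
open import Induction.WellFounded using (WellFounded; Acc; acc)
open import Relation.Binary.Construct.Closure.Transitive using (TransClosure) renaming ([_] to [_]⁺; _++_ to _++⁺_)
open import Relation.Binary.PropositionalEquality using (_≡_; _≢_; refl; sym; trans; cong; cong₂; subst; resp₂; isEquivalence)
open import Relation.Binary.PropositionalEquality.Properties using (setoid)
open import Relation.Nullary using (¬_; Dec; yes; no; does; ¬?; _×-dec_; _⊎-dec_; _→-dec_)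
open import Relation.Nullary.Decidable using (decidable-stable; dec-true; ¬¬-excluded-middle)
open import Relation.Unary using (Decidable)
import Data.List.Membership.DecPropositional as DecMembership
import Data.List.Relation.Binary.Permutation.Setoid.Properties as PermutationSetoid
import Data.List.Relation.Unary.All.Properties as AllP

-- Lists without repetition.

module _ {A : Set} where

  Unique-resp-↭ : {xs ys : List A} → xs ↭ ys → Unique xs → Unique ys
  Unique-resp-↭ σ = PermutationSetoid.Unique-resp-↭ (setoid A) (↭⇒↭ₛ σ)

  ∉⇒Unique-∷ : ∀ {x : A} {xs} → x ∉ xs → Unique xs → Unique (x ∷ xs)
  ∉⇒Unique-∷ x∉ u = All.tabulate (λ y∈ x≡y → x∉ (subst (_∈ _) (sym x≡y) y∈)) ∷ u

  Unique-∷⇒∉ : ∀ {x : A} {xs} → Unique (x ∷ xs) → x ∉ xs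
  Unique-∷⇒∉ (x≢ ∷ _) x∈ = All.lookup x≢ x∈ refl

  Unique-∷⇒Unique : ∀ {x : A} {xs} → Unique (x ∷ xs) → Unique xs
  Unique-∷⇒Unique (_ ∷ u) = u

  Unique-++⁻ : ∀ (xs : List A) {ys} → Unique (xs ++ ys) →
               Unique xs × Unique ys × Disjoint xs ys
  Unique-++⁻ []       u        = [] , u , λ ()
  Unique-++⁻ (x ∷ xs) (x≢ ∷ u) with Unique-++⁻ xs u
  ... | uxs , uys , dis = ∉⇒Unique-∷ (Unique-∷⇒∉ (x≢ ∷ u) ∘ ∈-++⁺ˡ) uxs , uys , λ where
    (here refl , y∈) → Unique-∷⇒∉ (x≢ ∷ u) (∈-++⁺ʳ xs y∈)
    (there x∈ , y∈)  → dis (x∈ , y∈)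

-- Incidence and cusps in a proof structure.

module Structure {nV nE : ℕ} (ρ : Struct (Fin nV) (Fin nE)) (isPS : IsProofStructure ρ) where

  open IsProofStructure isPS

  V : Set
  V = Fin nV

  E : Set
  E = Fin nE

  open DecMembership (_≟_ {nV}) using (_∈?_)

  Inc : E → V → Set
  Inc e v = e ∈ concs (node ρ v) ⊎ e ∈ prems (node ρ v)

  conc-not-prem : ∀ {e v} → e ∈ concs (node ρ v) → e ∉ prems (node ρ v)
  conc-not-prem {v = v} e∈c e∈p =
    proj₂ (proj₂ (Unique-++⁻ (concs (node ρ v)) (portsDistinct v))) (e∈c , e∈p)

  link-sym : ∀ {e v w} → Link ρ e v w → Link ρ e w v
  link-sym (inj₁ (c , p)) = inj₂ (p , c)
  link-sym (inj₂ (p , c)) = inj₁ (c , p)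

  link-irrefl : ∀ {e v} → ¬ Link ρ e v v
  link-irrefl (inj₁ (c , p)) = conc-not-prem c p
  link-irrefl (inj₂ (p , c)) = conc-not-prem c p

  link-incʳ : ∀ {e v w} → Link ρ e v w → Inc e w
  link-incʳ (inj₁ (c , p)) = inj₂ p
  link-incʳ (inj₂ (p , c)) = inj₁ c

  link-incˡ : ∀ {e v w} → Link ρ e v w → Inc e v
  link-incˡ = link-incʳ ∘ link-sym

  link-endpoints : ∀ {e v w x} → Link ρ e v w → Inc e x → x ≡ v ⊎ x ≡ w
  link-endpoints (inj₁ (c , p)) (inj₁ cx) = inj₁ (uniqueSrc _ _ _ cx c)
  link-endpoints (inj₁ (c , p)) (inj₂ px) = inj₂ (uniqueTgt _ _ _ px p)
  link-endpoints (inj₂ (p , c)) (inj₁ cx) = inj₂ (uniqueSrc _ _ _ cx c)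
  link-endpoints (inj₂ (p , c)) (inj₂ px) = inj₁ (uniqueTgt _ _ _ px p)

  Par : V → E → Set
  Par u c = ∃[ l ] ∃[ r ] (node ρ u ≡ parN l r c)

  par-unique : ∀ {u c c′} → Par u c → Par u c′ → c ≡ c′
  par-unique (_ , _ , eq) (_ , _ , eq′) with trans (sym eq) eq′
  ... | refl = refl

  -- A path through u that uses e and f has no cusp at u.
  Ok : V → E → E → Set
  Ok u e f = e ≢ f × (∀ {c} → Par u c → e ≡ c ⊎ f ≡ c)

  ok-sym : ∀ {u e f} → Ok u e f → Ok u f e
  ok-sym (e≢f , h) = e≢f ∘ sym , λ p → [ inj₂ , inj₁ ]′ (h p)

  par-ok : ∀ {u c e} → Par u c → e ≢ c → Ok u e c
  par-ok p e≢c = e≢c , λ p′ → inj₂ (par-unique p p′)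

  par? : ∀ u → Dec (∃ (Par u))
  par? u with node ρ u
  ... | axN _ _     = no λ { (_ , _ , _ , ()) }
  ... | cutN _ _    = no λ { (_ , _ , _ , ()) }
  ... | tensN _ _ _ = no λ { (_ , _ , _ , ()) }
  ... | parN l r c  = yes (c , l , r , refl)

  -- In the second case `u` is a ⅋-vertex and neither edge is its conclusion, so a path turning from
  -- `e` to `f` at `u` would have a cusp there.
  ok-or-cusp : ∀ u {e f} → e ≢ f → Ok u e f ⊎ ∃[ c ] (Par u c × e ≢ c × f ≢ c)
  ok-or-cusp u {e} {f} e≢f with par? u
  ... | no ¬p = inj₁ (e≢f , λ p → ⊥-elim (¬p (_ , p)))
  ... | yes (c , p) with e ≟ c | f ≟ c
  ...   | yes refl | _       = inj₁ (ok-sym (par-ok p (e≢f ∘ sym)))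
  ...   | no _    | yes refl = inj₁ (par-ok p e≢f)
  ...   | no e≢c  | no f≢c   = inj₂ (c , p , e≢c , f≢c)

  -- Cusp-free routes inside a set of vertices.

  module Within (U : Subset nV) where

    Step : E → V → V → Set
    Step e v w = Link ρ e v w × v ∈ˢ U × w ∈ˢ U

    step-sym : ∀ {e v w} → Step e v w → Step e w v
    step-sym (l , v∈ , w∈) = link-sym l , w∈ , v∈

    -- Non-empty paths without cusp, indexed by their first and last vertices and edges.
    data Route : V → E → V → E → Set where
      one  : ∀ {v e w} → Step e v w → Route v e w e
      cons : ∀ {v e u e′ w f} → Step e v u → Ok u e e′ → Route u e′ w f → Route v e w f

    private variable
      u v w x : V
      e e′ f g c c′ : E

    -- All the vertices of a route but the last one.
    verts : Route v e w f → List V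
    verts {v = v} (one _)      = v ∷ []
    verts {v = v} (cons _ _ p) = v ∷ verts p

    start∈verts : (p : Route v e w f) → v ∈ verts p
    start∈verts (one _)      = here refl
    start∈verts (cons _ _ _) = here refl

    last-link : (p : Route v e w f) → ∃[ y ] (y ∈ verts p × Link ρ f y w)
    last-link (one s)      = _ , here refl , proj₁ s
    last-link (cons _ _ p) with last-link p
    ... | y , y∈ , l = y , there y∈ , l

    Simple : Route v e w f → Set
    Simple {w = w} p = Unique (w ∷ verts p)

    append : Route v e u f → Ok u f e′ → Route u e′ w g → Route v e w g
    append (one s)       o q = cons s o q
    append (cons s o′ p) o q = cons s o′ (append p o q)

    verts-append : (p : Route v e u f) (o : Ok u f e′) (q : Route u e′ w g) →
                   verts (append p o q) ≡ verts p ++ verts q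
    verts-append (one s)       o q = refl
    verts-append (cons s o′ p) o q = cong (_ ∷_) (verts-append p o q)

    rev : Route v e w f → Route w f v e
    rev (one s)      = one (step-sym s)
    rev (cons s o p) = append (rev p) (ok-sym o) (one (step-sym s))

    -- Since `verts` omits the final vertex, a route and its reverse omit opposite endpoints; each
    -- side restores the one that is missing.
    verts-rev : (p : Route v e w f) → v ∷ verts (rev p) ↭ w ∷ verts p
    verts-rev (one s) = swap _ _ ↭-refl
    verts-rev {v} {w = w} (cons {u = u} s o p)
      rewrite verts-append (rev p) (ok-sym o) (one (step-sym s)) =
      ↭-trans (prep v (↭-sym (∷↭∷ʳ u (verts (rev p)))))
        (↭-trans (prep v (verts-rev p)) (swap v w ↭-refl))

    -- Routes are non-empty, so a cut at the first vertex needs a case of its own.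
    data SplitAt (p : Route v e w f) (x : V) : Set where
      atStart : x ≡ v → SplitAt p x
      inside  : ∀ {a b} (A : Route v e x a) → Ok x a b → (B : Route x b w f) →
                verts p ≡ verts A ++ verts B → SplitAt p x

    splitAt : (p : Route v e w f) → x ∈ verts p → SplitAt p x
    splitAt (one _)      (here eq) = atStart eq
    splitAt (cons _ _ _) (here eq) = atStart eq
    splitAt (cons s o p) (there x∈) with splitAt p x∈
    ... | atStart refl      = inside (one s) o p refl
    ... | inside A o′ B eq = inside (cons s o A) o′ B (cong (_ ∷_) eq)

    split-unique : (A : Route v e x f) (B : Route x e′ w g) → Unique (verts A ++ verts B) →
                   Simple A × Unique (verts B)
    split-unique A B u with Unique-++⁻ (verts A) u
    ... | uA , uB , dis = ∉⇒Unique-∷ (λ x∈A → dis (x∈A , start∈verts B)) uA , uB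

    truncate : (p : Route v e w f) → Simple p → x ∈ verts p → x ≢ v →
               ∃[ g ] Σ (Route v e x g) Simple
    truncate p sp x∈ x≢v with splitAt p x∈
    ... | atStart x≡v     = ⊥-elim (x≢v x≡v)
    ... | inside A _ B eq = _ , A , proj₁ (split-unique A B (subst Unique eq (Unique-∷⇒Unique sp)))

    append-unique : (p : Route v e u f) (o : Ok u f e′) (q : Route u e′ w g) →
                    Unique (verts p) → Unique (verts q) → Disjoint (verts p) (verts q) →
                    Unique (verts (append p o q))
    append-unique p o q up uq dis rewrite verts-append p o q = ++⁺ up uq dis

    extend-unique : (p : Route v e u f) (o : Ok u f e′) (s : Step e′ u w) → Simple p →
                    Unique (verts (append p o (one s)))
    extend-unique p o s sp = append-unique p o (one s) (Unique-∷⇒Unique sp) ([] ∷ [])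
      λ { (y∈ , here refl) → Unique-∷⇒∉ sp y∈ }

    -- On a longer route the last edge joins `u` to a vertex visited after `v`. Were it also
    -- incident to `v`, either `v` would be repeated or the edge would be a loop.
    return-edge : (p : Route v c u f) → Unique (verts p) → Link ρ f v u → f ≡ c
    return-edge (one _)      _  _ = refl
    return-edge (cons _ _ p) up l with last-link p
    ... | y , y∈ , l′ with link-endpoints l′ (link-incˡ l)
    ...   | inj₁ refl = ⊥-elim (Unique-∷⇒∉ up y∈)
    ...   | inj₂ refl = ⊥-elim (link-irrefl l)

    -- If the closed walk made of `B` and `Q` turned back at `x` along one edge, the other end of
    -- this edge would lie on both routes. The exception is `B` being that single edge; then
    -- `return-edge` makes it `c`, against `f ≢ c`.
    first≢last : (B : Route x e u f) (Q : Route u c x g) → Unique (verts Q) →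
                 Disjoint (verts Q) (verts B) → f ≢ c → g ≢ e
    first≢last B Q uQ dis f≢c refl with last-link Q
    first≢last (one (l , _)) Q uQ dis f≢c refl | y , y∈ , l′ =
      f≢c (return-edge Q uQ (link-sym l))
    first≢last (cons (l , _) _ B) Q uQ dis f≢c refl | y , y∈ , l′
      with link-endpoints l′ (link-incʳ l)
    ... | inj₁ refl = dis (y∈ , there (start∈verts B))
    ... | inj₂ refl = link-irrefl l

    -- The route is stopped at its first vertex in `xs`. The last component keeps track of the
    -- visited vertices, so that uniqueness survives the recursion.
    first-hit : (xs : List V) → u ∉ xs → (q : Route u c x g) → Unique (verts q) → x ∈ xs →
                ∃[ y ] ∃[ h ] Σ (Route u c y h) λ q′ →
                  Unique (verts q′) × y ∈ xs × Disjoint (verts q′) xs ×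
                  (∀ {z} → z ∈ verts q′ → z ∈ verts q)
    first-hit xs u∉ q@(one _) uq x∈ =
      _ , _ , q , uq , x∈ , (λ { (here refl , u∈) → u∉ u∈ }) , λ z∈ → z∈
    first-hit xs u∉ (cons {u = y} s o q) uq x∈ with y ∈? xs
    ... | yes y∈ = y , _ , one s , [] ∷ [] , y∈ , (λ { (here refl , u∈) → u∉ u∈ }) ,
                   λ { (here eq) → here eq }
    ... | no y∉ with first-hit xs y∉ q (Unique-∷⇒Unique uq) x∈
    ...   | z , h , q′ , uq′ , z∈ , dis , sub =
      z , h , cons s o q′ , ∉⇒Unique-∷ (Unique-∷⇒∉ uq ∘ sub) uq′ , z∈ ,
      (λ { (here refl , u∈) → u∉ u∈ ; (there w∈ , w∈′) → dis (w∈ , w∈′) }) ,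
      λ { (here eq) → here eq ; (there w∈) → there (sub w∈) }

    edges : Route v e w f → List E
    edges (one {e = e} _)      = e ∷ []
    edges (cons {e = e} _ _ p) = e ∷ edges p

    to-path : (p : Route v e w f) → Path ρ v w (edges p) (verts p)
    to-path (one s)      = proj₁ s ∷ []
    to-path (cons s _ p) = proj₁ s ∷ to-path p

    end∈U : Route v e w f → w ∈ˢ U
    end∈U (one s)      = proj₂ (proj₂ s)
    end∈U (cons _ _ p) = end∈U p

    inc-visited : (p : Route v e w f) → g ∈ edges p → Inc g x → x ∈ w ∷ verts p
    inc-visited (one s) (here refl) i with link-endpoints (proj₁ s) i
    ... | inj₁ refl = there (here refl)
    ... | inj₂ refl = here refl
    inc-visited (cons s _ p) (here refl) i with link-endpoints (proj₁ s) i
    ... | inj₁ refl = there (here refl)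
    ... | inj₂ refl = there (there (start∈verts p))
    inc-visited (cons s _ p) (there g∈) i with inc-visited p g∈ i
    ... | here eq  = here eq
    ... | there x∈ = there (there x∈)

    simple-tail : (s : Step e v u) (o : Ok u e e′) (p : Route u e′ w f) →
                  Simple (cons s o p) → Simple p × v ∉ w ∷ verts p
    simple-tail s o p sp with Unique-resp-↭ (swap _ _ ↭-refl) sp
    ... | u = Unique-∷⇒Unique u , Unique-∷⇒∉ u

    start-edge : (p : Route v e w f) → Simple p → g ∈ edges p → Inc g v → g ≡ e
    start-edge (one _)      _  (here refl) _ = refl
    start-edge (cons _ _ _) _  (here refl) _ = refl
    start-edge (cons s o p) sp (there g∈)  i =
      ⊥-elim (proj₂ (simple-tail s o p sp) (inc-visited p g∈ i))

    end-edge : (p : Route v e w f) → Simple p → g ∈ edges p → Inc g w → g ≡ f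
    end-edge (one _)      _  (here refl) _ = refl
    end-edge (cons s o p) sp (there g∈)  i = end-edge p (proj₁ (simple-tail s o p sp)) g∈ i
    end-edge (cons s o p) sp (here refl) i with link-endpoints (proj₁ s) i
    ... | inj₁ refl = ⊥-elim (Unique-∷⇒∉ sp (here refl))
    ... | inj₂ refl = ⊥-elim (Unique-∷⇒∉ sp (there (start∈verts p)))

    edges-unique : (p : Route v e w f) → Simple p → Unique (edges p)
    edges-unique (one _)      _  = [] ∷ []
    edges-unique (cons s o p) sp with simple-tail s o p sp
    ... | sp′ , v∉ = ∉⇒Unique-∷ (λ e∈ → v∉ (inc-visited p e∈ (link-incˡ (proj₁ s))))
                                (edges-unique p sp′)

    -- A simple route passes through each vertex at most once, so two of its edges that share a
    -- vertex are consecutive there.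
    crossing-ok : (p : Route v e w f) → Simple p → e′ ∈ edges p → g ∈ edges p → e′ ≢ g →
                  Inc e′ x → Inc g x → Ok x e′ g
    crossing-ok (one _) _ (here refl) (here refl) ne _ _ = ⊥-elim (ne refl)
    crossing-ok (cons s o p) sp a∈ b∈ ne ia ib with simple-tail s o p sp
    crossing-ok (cons s o p) sp (here refl) (here refl) ne ia ib | _ = ⊥-elim (ne refl)
    crossing-ok (cons s o p) sp (there a∈)  (there b∈)  ne ia ib | sp′ , _ =
      crossing-ok p sp′ a∈ b∈ ne ia ib
    crossing-ok (cons s o p) sp (here refl) (there b∈)  ne ia ib | sp′ , v∉
      with link-endpoints (proj₁ s) ia
    ... | inj₁ refl = ⊥-elim (v∉ (inc-visited p b∈ ib))
    ... | inj₂ refl rewrite start-edge p sp′ b∈ ib = o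
    crossing-ok (cons s o p) sp (there a∈)  (here refl) ne ia ib | sp′ , v∉
      with link-endpoints (proj₁ s) ib
    ... | inj₁ refl = ⊥-elim (v∉ (inc-visited p a∈ ia))
    ... | inj₂ refl rewrite start-edge p sp′ a∈ ia = ok-sym o

    -- Any two edges of the cycle that meet at a vertex are consecutive there, possibly across the
    -- base point. Both premises of a ⅋-vertex would thus form a cusp, which `Ok` forbids.
    to-switching-cycle : (p : Route v e v f) → Unique (verts p) → Ok v f e → SwitchingCycle ρ
    to-switching-cycle (one s) _ _ = ⊥-elim (link-irrefl (proj₁ s))
    to-switching-cycle {v} {e} {f} p₀@(cons {u = u} {e′} s o p) sp ok = record
      { path      = to-path p₀
      ; nonEmpty  = λ ()
      ; simpleE   = ∉⇒Unique-∷ e∉p (edges-unique p sp)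
      ; simpleV   = sp
      ; switching = λ x l r c eq (l∈ , r∈) → cusp-free eq l∈ r∈
      }
      where
      e∉p : e ∉ edges p
      e∉p e∈ = proj₁ o (start-edge p sp e∈ (link-incʳ (proj₁ s)))

      meet-e : g ∈ edges p → Inc e x → Inc g x → Ok x g e
      meet-e g∈ i j with link-endpoints (proj₁ s) i
      ... | inj₁ refl rewrite end-edge p sp g∈ j   = ok
      ... | inj₂ refl rewrite start-edge p sp g∈ j = ok-sym o

      crossing : ∀ {a b} → a ∈ e ∷ edges p → b ∈ e ∷ edges p → a ≢ b → Inc a x → Inc b x → Ok x a b
      crossing (here refl) (here refl) a≢b _ _ = ⊥-elim (a≢b refl)
      crossing (here refl) (there b∈)  _   i j = ok-sym (meet-e b∈ i j)
      crossing (there a∈)  (here refl) _   i j = meet-e a∈ j i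
      crossing (there a∈)  (there b∈)  a≢b i j = crossing-ok p sp a∈ b∈ a≢b i j

      cusp-free : ∀ {l r} → node ρ x ≡ parN l r c → l ∈ e ∷ edges p → r ∉ e ∷ edges p
      cusp-free {x} {c} {l} {r} eq l∈ r∈ with subst (λ n → Unique (concs n ++ prems n)) eq (portsDistinct x)
      ... | (c≢l ∷ c≢r ∷ []) ∷ (l≢r ∷ []) ∷ _ with
        proj₂ (crossing l∈ r∈ l≢r (inj₂ (subst (λ n → l ∈ prems n) (sym eq) (here refl)))
                                  (inj₂ (subst (λ n → r ∈ prems n) (sym eq) (there (here refl)))))
              (l , r , eq)
      ...   | inj₁ l≡c = c≢l (sym l≡c)
      ...   | inj₂ r≡c = c≢r (sym r≡c)

    -- Closing routes in the absence of cusp-free cycles.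

    module Acyclic
      (no-cycle : ∀ {v e f} (p : Route v e v f) → Unique (verts p) → ¬ Ok v f e) where

      -- A closed walk that leaves `v` through such a `c` has no cusp at `v`, whatever other edge it
      -- returns by. This holds for the conclusion of a ⅋-vertex and for any edge at a vertex of
      -- another kind.
      Principal : V → E → Set
      Principal v c = ∀ {g} → g ≢ c → Ok v g c

      -- Let `Q` come back to `P` at `x`. If `x` is `v`, then `P` followed by `Q` is a cusp-free
      -- cycle. Otherwise `P` is `A` followed by `B`, and `B` followed by `Q` must have a cusp at
      -- `x`. As `P` has none, `A` enters `x` by its conclusion, so `A` can be continued by the
      -- reverse of `Q`, which reaches `u` through its conclusion.
      reroute : Principal v c → (P : Route v c u f) → Simple P → Par u c′ → f ≢ c′ →
                (Q : Route u c′ x g) → Unique (verts Q) → x ∈ verts P →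
                Disjoint (verts Q) (verts P) → Σ (Route v c u c′) Simple
      reroute {v} {u = u} {c′ = c′} {x} {g} pr P sP pu f≢c′ Q uQ x∈ dis with splitAt P x∈
      ... | atStart refl =
        ⊥-elim (no-cycle (append P (par-ok pu f≢c′) Q)
          (append-unique P _ Q (Unique-∷⇒Unique sP) uQ λ { (a , b) → dis (b , a) })
          (pr (first≢last P Q uQ dis f≢c′)))
      ... | inside {a} {b} A o B eq = go (ok-or-cusp x g≢b)
        where
        uAB : Unique (verts A ++ verts B)
        uAB = subst Unique eq (Unique-∷⇒Unique sP)

        disA : Disjoint (verts Q) (verts A)
        disA (y∈Q , y∈A) = dis (y∈Q , subst (_ ∈_) (sym eq) (∈-++⁺ˡ y∈A))

        disB : Disjoint (verts Q) (verts B)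
        disB (y∈Q , y∈B) = dis (y∈Q , subst (_ ∈_) (sym eq) (∈-++⁺ʳ (verts A) y∈B))

        g≢b : g ≢ b
        g≢b = first≢last B Q uQ disB f≢c′

        unique-A-revQ : Unique (u ∷ verts A ++ verts (rev Q))
        unique-A-revQ = Unique-resp-↭ (shift u (verts A) (verts (rev Q)))
          (++⁺ (Unique-∷⇒Unique (proj₁ (split-unique A B uAB)))
               (Unique-resp-↭ (↭-sym (verts-rev Q)) sQ)
               λ { (y∈A , y∈) → disj y∈A (∈-resp-↭ (verts-rev Q) y∈) })
          where
          sQ : Simple Q
          sQ = ∉⇒Unique-∷ (λ x∈Q → dis (x∈Q , x∈)) uQ
          disj : ∀ {y} → y ∈ verts A → y ∈ x ∷ verts Q → ⊥
          disj y∈A (here refl) = Unique-∷⇒∉ (proj₁ (split-unique A B uAB)) y∈A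
          disj y∈A (there y∈Q) = disA (y∈Q , y∈A)

        go : Ok x g b ⊎ ∃[ d ] (Par x d × g ≢ d × b ≢ d) → Σ (Route v _ u c′) Simple
        go (inj₁ ok) = ⊥-elim (no-cycle (append B (par-ok pu f≢c′) Q)
          (append-unique B _ Q (proj₂ (split-unique A B uAB)) uQ λ { (a , b) → disB (b , a) })
          ok)
        go (inj₂ (d , px , g≢d , b≢d)) with proj₂ o px
        ... | inj₂ b≡d = ⊥-elim (b≢d b≡d)
        -- Here the last edge of `A` is the conclusion of `x`, so turning from it into `g` is no
        -- cusp.
        ... | inj₁ refl = append A ok′ (rev Q) ,
                subst (λ xs → Unique (u ∷ xs)) (sym (verts-append A ok′ (rev Q))) unique-A-revQ
          where
          ok′ : Ok x a g
          ok′ = ok-sym (par-ok px g≢d)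

      NoHit : V → E → List V → Set
      NoHit u c xs = ∀ {x g} (q : Route u c x g) → Unique (verts q) → x ∉ xs

      -- The hypothesis `maximal` is stated on routes rather than through `◁`, so that `v` may also
      -- be a cut- or ⊗-vertex.
      module Closing {v c} (pr : Principal v c)
        (maximal : ∀ {u f c′} (P : Route v c u f) → Simple P → Par u c′ → f ≢ c′ → ¬ NoHit u c′ (verts P))
        where

        -- If turning from `f` into `e` is a cusp, `maximal` refutes that no route through the
        -- conclusion of `u` meets `P`. Cutting such a route at its first hit, `reroute` reaches `u`
        -- through its conclusion, from where `e` is free. The double negation comes from `maximal`
        -- being a refutation.
        avoid-cusp : (P : Route v c u f) → Simple P → f ≢ e →
                     ¬ (∀ {f′} (P′ : Route v c u f′) → Simple P′ → ¬ Ok u f′ e)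
        avoid-cusp {u} P sP f≢e k with ok-or-cusp u f≢e
        ... | inj₁ ok = k P sP ok
        ... | inj₂ (c′ , pu , f≢c′ , e≢c′) =
          maximal P sP pu f≢c′ λ q uq x∈ →
            let y , h , q′ , uq′ , y∈ , dis , _ = first-hit (verts P) (Unique-∷⇒∉ sP) q uq x∈
                P′ , sP′ = reroute pr P sP pu f≢c′ q′ uq′ y∈ dis
            in k P′ sP′ (ok-sym (par-ok pu e≢c′))

        -- Walks back to v that avoid c; they may have cusps and repeat vertices.
        data Back : V → Set where
          stop : Step g u v → g ≢ c → Back u
          step : Step e u w → w ≢ v → Back w → Back u

        -- Cusp minimisation: P has no cusp and each step shortens the rest of the closed walk.
        no-return : Back u → (P : Route v c u f) → ¬ Simple P
        no-return {f = f} (stop {g} s g≢c) P sP with f ≟ g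
        -- The last edge of `P` is incident to `v`, so on a simple route it is the first edge `c`.
        ... | yes refl = g≢c (return-edge P (Unique-∷⇒Unique sP) (link-sym (proj₁ s)))
        ... | no f≢g = avoid-cusp P sP f≢g λ P′ sP′ ok →
          no-cycle (append P′ ok (one s)) (extend-unique P′ ok s sP′) (pr g≢c)
        no-return {u} {f} (step {e} {w = w} s w≢v b) P sP with f ≟ e
        ... | yes refl = backtrack (last-link P)
          where
          backtrack : ¬ (∃[ y ] (y ∈ verts P × Link ρ f y u))
          backtrack (y , y∈ , l) with link-endpoints l (link-incʳ (proj₁ s))
          ... | inj₂ refl = link-irrefl (proj₁ s)
          -- The walk goes back along the last edge of `P`, so `P` is cut at the vertex before it.
          ... | inj₁ refl with truncate P sP y∈ w≢v
          ...   | _ , A , sA = no-return b A sA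
        ... | no f≢e = avoid-cusp P sP f≢e continue
          where
          continue : ∀ {f′} (P′ : Route v c u f′) → Simple P′ → ¬ Ok u f′ e
          -- If `w` is already on `P′`, the loop is dropped; otherwise `P′` grows by one edge.
          continue P′ sP′ ok with w ∈? verts P′
          ... | yes w∈ with truncate P′ sP′ w∈ w≢v
          ...   | _ , A , sA = no-return b A sA
          continue P′ sP′ ok | no w∉ =
            no-return b (append P′ ok (one s)) (∉⇒Unique-∷ fresh (extend-unique P′ ok s sP′))
            where
            fresh : w ∉ verts (append P′ ok (one s))
            fresh w∈ rewrite verts-append P′ ok (one s) with ∈-++⁻ (verts P′) w∈
            ... | inj₁ w∈P = w∉ w∈P
            ... | inj₂ (here refl) = link-irrefl (proj₁ s)

      -- The order on ⅋-vertices.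

      record _◁_ (v u : V) : Set where
        field
          {cᵥ cᵤ last} : E
          parᵥ         : Par v cᵥ
          parᵤ         : Par u cᵤ
          route        : Route v cᵥ u last
          simple       : Simple route
          last≢        : last ≢ cᵤ
          no-hit       : NoHit u cᵤ (verts route)

      -- `NoHit` speaks only of endpoints of routes; a vertex inside `q` is the endpoint of a prefix
      -- of `q`.
      no-hit-disjoint : ∀ {xs} → u ∉ xs → NoHit u c xs → (q : Route u c w f) → Unique (verts q) →
                        Disjoint (verts q) xs
      no-hit-disjoint u∉ nh q uq (y∈q , y∈xs) with splitAt q y∈q
      ... | atStart refl    = u∉ y∈xs
      ... | inside A _ B eq =
        nh A (Unique-∷⇒Unique (proj₁ (split-unique A B (subst Unique eq uq)))) y∈xs

      ◁-irrefl : ∀ {v u} → v ≡ u → ¬ (v ◁ u)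
      ◁-irrefl refl d = Unique-∷⇒∉ (_◁_.simple d) (start∈verts (_◁_.route d))

      -- The two routes are composed at `u`. The composite is simple because the second route leaves
      -- `u` through its conclusion and so never meets the first.
      ◁-trans : ∀ {v u w} → v ◁ u → u ◁ w → v ◁ w
      ◁-trans {v} {u} {w} d d′ with par-unique (_◁_.parᵤ d) (_◁_.parᵥ d′)
      ... | refl = record
        { parᵥ   = D.parᵥ
        ; parᵤ   = D′.parᵤ
        ; route  = append D.route ok D′.route
        ; simple = ∉⇒Unique-∷ w∉ (append-unique D.route ok D′.route (Unique-∷⇒Unique D.simple) uP′
                     λ { (a , b) → no-hit-disjoint (Unique-∷⇒∉ D.simple) D.no-hit D′.route uP′ (b , a) })
        ; last≢  = D′.last≢
        ; no-hit = no-hit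
        }
        where
        module D  = _◁_ d
        module D′ = _◁_ d′

        ok : Ok u D.last D.cᵤ
        ok = par-ok D.parᵤ D.last≢

        ok′ : Ok w D′.last D′.cᵤ
        ok′ = par-ok D′.parᵤ D′.last≢

        uP′ : Unique (verts D′.route)
        uP′ = Unique-∷⇒Unique D′.simple

        w∉ : w ∉ verts (append D.route ok D′.route)
        w∉ w∈ rewrite verts-append D.route ok D′.route with ∈-++⁻ (verts D.route) w∈
        ... | inj₁ w∈P  = D.no-hit D′.route uP′ w∈P
        ... | inj₂ w∈P′ = Unique-∷⇒∉ D′.simple w∈P′

        no-hit : NoHit w D′.cᵤ (verts (append D.route ok D′.route))
        no-hit q uq x∈ rewrite verts-append D.route ok D′.route with ∈-++⁻ (verts D.route) x∈
        ... | inj₂ x∈P′ = D′.no-hit q uq x∈P′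
        -- Prefixed by the second route, `q` would leave `u` through its conclusion and hit the
        -- first route.
        ... | inj₁ x∈P  = D.no-hit (append D′.route ok′ q)
          (append-unique D′.route ok′ q uP′ uq
            λ { (a , b) → no-hit-disjoint (Unique-∷⇒∉ D′.simple) D′.no-hit q uq (b , a) }) x∈P

      ◁-noetherian : WellFounded (flip _◁_)
      ◁-noetherian = spo-noetherian {_≈_ = _≡_} record
        { isEquivalence = isEquivalence
        ; irrefl        = ◁-irrefl
        ; trans         = ◁-trans
        ; <-resp-≈      = resp₂ _◁_
        }

-- Decidable subsets of finite sets.

does-true : ∀ {P : Set} (d : Dec P) → does d ≡ true → P
does-true (yes p) _ = p

module _ {n : ℕ} {P : Fin n → Set} (P? : Decidable P) where

  comprehension : Subset n
  comprehension = tabulate (does ∘ P?)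

  ∈-comprehension⁺ : ∀ {x} → P x → x ∈ˢ comprehension
  ∈-comprehension⁺ {x} p = lookup⇒[]= x _ (trans (lookup∘tabulate _ x) (dec-true (P? x) p))

  ∈-comprehension⁻ : ∀ {x} → x ∈ˢ comprehension → P x
  ∈-comprehension⁻ {x} x∈ =
    does-true (P? x) (trans (sym (lookup∘tabulate _ x)) ([]=⇒lookup x∈))

-- Double negation commutes with finite conjunctions. Reachability may hence be assumed decidable
-- whenever the goal is a contradiction.
¬¬-decidable : ∀ {n} (P : Fin n → Set) → ¬ ¬ Decidable P
¬¬-decidable {zero}  P k = k λ ()
¬¬-decidable {suc n} P k = ¬¬-decidable (P ∘ suc) λ d →
  ¬¬-excluded-middle λ p? → k λ { zero → p? ; (suc i) → d i }

-- Existence of a splitting vertex.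

left right : ∀ {E} → Node E → List E
left  (cutN l _)    = l ∷ []
left  (tensN l _ _) = l ∷ []
left  _             = []
right (cutN _ r)    = r ∷ []
right (tensN _ r _) = r ∷ []
right _             = []

left⊆prems : ∀ {E} {e : E} n → e ∈ left n → e ∈ prems n
left⊆prems (cutN _ _)    (here eq) = here eq
left⊆prems (tensN _ _ _) (here eq) = here eq

right⊆prems : ∀ {E} {e : E} n → e ∈ right n → e ∈ prems n
right⊆prems (cutN _ _)    (here eq) = there (here eq)
right⊆prems (tensN _ _ _) (here eq) = there (here eq)

left∩right : ∀ {E} {e : E} n → Unique (concs n ++ prems n) → e ∈ left n → e ∉ right n
left∩right (cutN _ _)    ((l≢r ∷ []) ∷ _)     (here refl) (here refl) = l≢r refl
left∩right (tensN _ _ _) (_ ∷ (l≢r ∷ []) ∷ _) (here refl) (here refl) = l≢r refl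

module Splitting {nV nE : ℕ} (ρ : Struct (Fin nV) (Fin nE)) (net : IsProofNet ρ) where

  open IsProofNet net
  open IsProofStructure isPS
  open Structure ρ isPS
  open DecMembership (_≟_ {nE}) using (_∈?_)

  Terminal : Subset nV → V → Set
  Terminal U v = ∀ w → w ∈ˢ U → ¬ Arc ρ v w

  Separates : Subset nV → V → Subset nV → Set
  Separates U v A = ∀ x y → x ∈ˢ U → y ∈ˢ U → x ≢ v → y ≢ v →
                    x ∈ˢ A → y ∉ˢ A → ∀ e → ¬ Link ρ e x y

  -- Only cut- and ⊗-vertices have a left and a right, so other kinds impose nothing here. A premise
  -- without source in `U` imposes nothing either.
  Sides : Subset nV → V → Subset nV → Set
  Sides U v A = ∀ x e → x ∈ˢ U → e ∈ concs (node ρ x) →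
                (e ∈ left (node ρ v) → x ∈ˢ A) × (e ∈ right (node ρ v) → x ∉ˢ A)

  Splits : Subset nV → V → Subset nV → Set
  Splits U v A = v ∈ˢ U × Terminal U v × Separates U v A × Sides U v A

  arc? : ∀ v w → Dec (Arc ρ v w)
  arc? v w = any? λ e → (e ∈? concs (node ρ v)) ×-dec (e ∈? prems (node ρ w))

  link? : ∀ e v w → Dec (Link ρ e v w)
  link? e v w = ((e ∈? concs (node ρ v)) ×-dec (e ∈? prems (node ρ w)))
          ⊎-dec ((e ∈? prems (node ρ v)) ×-dec (e ∈? concs (node ρ w)))

  splits? : ∀ U v A → Dec (Splits U v A)
  splits? U v A =
    (v ∈ˢ? U)
    ×-dec (all? λ w → (w ∈ˢ? U) →-dec ¬? (arc? v w))
    ×-dec (all? λ x → all? λ y → (x ∈ˢ? U) →-dec (y ∈ˢ? U) →-dec ¬? (x ≟ v) →-dec ¬? (y ≟ v) →-dec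
             (x ∈ˢ? A) →-dec ¬? (y ∈ˢ? A) →-dec (all? λ e → ¬? (link? e x y)))
    ×-dec (all? λ x → all? λ e → (x ∈ˢ? U) →-dec (e ∈? concs (node ρ x)) →-dec
             (((e ∈? left (node ρ v)) →-dec (x ∈ˢ? A))
               ×-dec ((e ∈? right (node ρ v)) →-dec ¬? (x ∈ˢ? A))))

  arc-noetherian : WellFounded (flip (TransClosure (Arc ρ)))
  arc-noetherian = spo-noetherian {_≈_ = _≡_} record
    { isEquivalence = isEquivalence
    ; irrefl        = λ { refl a → acyclic _ a }
    ; trans         = _++⁺_
    ; <-resp-≈      = resp₂ _
    }

  par-concs : ∀ {v c e} → Par v c → e ∈ concs (node ρ v) → e ≡ c
  par-concs (_ , _ , eq) e∈ with subst (λ n → _ ∈ concs n) eq e∈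
  ... | here e≡c = e≡c

  par-conc : ∀ {v c} → Par v c → c ∈ concs (node ρ v)
  par-conc (_ , _ , eq) = subst (λ n → _ ∈ concs n) (sym eq) (here refl)

  no-sides : ∀ {U v A} → left (node ρ v) ≡ [] → right (node ρ v) ≡ [] → Sides U v A
  no-sides l≡ r≡ x e _ _ = (λ e∈ → ⊥-elim (∉[] (subst (e ∈_) l≡ e∈))) ,
                           (λ e∈ → ⊥-elim (∉[] (subst (e ∈_) r≡ e∈)))
    where
    ∉[] : ∀ {e : E} → e ∉ []
    ∉[] ()

  -- The ax and ⅋ rules do not divide the rest of the net in two, so for them the trivial separation
  -- is enough.
  splits-∅ : ∀ {U v} → v ∈ˢ U → Terminal U v →
             left (node ρ v) ≡ [] → right (node ρ v) ≡ [] → Splits U v ∅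
  splits-∅ v∈ term l≡ r≡ = v∈ , term , (λ _ _ _ _ _ _ x∈∅ → ⊥-elim (∉⊥ x∈∅)) , no-sides l≡ r≡

  module Reachability (U : Subset nV) where

    open Within U public
    open Acyclic (λ p up ok → noSwitchingCycle (to-switching-cycle p up ok)) public

    -- Walks that leave `v` through `c` and do not come back to it; cusps and repetitions are
    -- allowed, which makes this plain connectedness.
    data Reached (v : V) (c : E) : V → Set where
      start : ∀ {x} → Step c v x → Reached v c x
      next  : ∀ {x y e} → Reached v c x → Step e x y → y ≢ v → Reached v c y

    reached∈U : ∀ {v c x} → Reached v c x → x ∈ˢ U
    reached∈U (start s)    = proj₂ (proj₂ s)
    reached∈U (next _ s _) = proj₂ (proj₂ s)

    reached≢ : ∀ {v c x} → Reached v c x → x ≢ v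
    reached≢ (start s)      refl = link-irrefl (proj₁ s)
    reached≢ (next _ _ x≢v) x≡v  = x≢v x≡v

    module _ {v c} (pr : Principal v c)
      (maximal : ∀ {u f c′} (P : Route v c u f) → Simple P → Par u c′ → f ≢ c′ → ¬ NoHit u c′ (verts P))
      where

      open Closing pr maximal

      -- The walk from `v` to `x` is moved edge by edge in front of the walk back, until only `c`
      -- remains as the simple route that `no-return` starts from.
      not-back : ∀ {x} → Reached v c x → ¬ Back x
      not-back (start s) b =
        no-return b (one s) (∉⇒Unique-∷ (λ { (here refl) → link-irrefl (proj₁ s) }) ([] ∷ []))
      not-back (next r s x≢v) b = not-back r (step s x≢v b)

      return-only : ∀ {x g} → Reached v c x → Step g x v → g ≡ c
      return-only {g = g} r s with g ≟ c
      ... | yes g≡c = g≡c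
      ... | no g≢c  = ⊥-elim (not-back r (stop s g≢c))

  -- If the conclusion c of the par-vertex v is a bridge to t, the part D below c is a smaller
  -- net, and what splits D splits the whole once the rest is put on the side where c is attached.
  module Bridge (U D : Subset nV) {v t c} (v∉D : v ∉ˢ D) (t∈D : t ∈ˢ D)
    (c∈v : c ∈ concs (node ρ v)) (c∈t : c ∈ prems (node ρ t)) (D⊆U : ∀ {x} → x ∈ˢ D → x ∈ˢ U)
    (leave : ∀ {x y e} → x ∈ˢ D → y ∈ˢ U → y ∉ˢ D → Link ρ e x y → y ≡ v × e ≡ c)
    where

    bridge : ∀ {x y e} → x ∈ˢ D → y ∈ˢ U → y ∉ˢ D → Link ρ e x y → y ≡ v × e ≡ c × x ≡ t
    bridge x∈ y∈ y∉ l with leave x∈ y∈ y∉ l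
    ... | refl , refl with link-endpoints l (inj₂ c∈t)
    ...   | inj₁ t≡x = refl , refl , sym t≡x
    ...   | inj₂ refl = ⊥-elim (v∉D t∈D)

    module _ {u A} (sp : Splits D u A) where

      -- All links between `D` and the rest are `c` at `t`, so the rest takes the side of `t`. If
      -- `t` is `u` itself, the side is decided by the port of `u` that `c` is attached to.
      OnLeft : Set
      OnLeft = (t ∈ˢ A × t ≢ u) ⊎ c ∈ left (node ρ u)

      InA⁺ : V → Set
      InA⁺ x = (x ∈ˢ D × x ∈ˢ A) ⊎ (x ∉ˢ D × OnLeft)

      inA⁺? : Decidable InA⁺
      inA⁺? x = ((x ∈ˢ? D) ×-dec (x ∈ˢ? A))
          ⊎-dec (¬? (x ∈ˢ? D) ×-dec (((t ∈ˢ? A) ×-dec ¬? (t ≟ u)) ⊎-dec (c ∈? left (node ρ u))))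

      A⁺ : Subset nV
      A⁺ = comprehension inA⁺?

      extend : Splits U u A⁺
      extend = D⊆U u∈D , term⁺ , sep⁺ , λ x e x∈U e∈x →
        (λ e∈l → ∈-comprehension⁺ inA⁺? (sideˡ x∈U e∈x e∈l)) ,
        (λ e∈r → sideʳ x∈U e∈x e∈r ∘ ∈-comprehension⁻ inA⁺?)
        where
        u∈D : u ∈ˢ D
        u∈D = proj₁ sp

        term : Terminal D u
        term = proj₁ (proj₂ sp)

        sep : Separates D u A
        sep = proj₁ (proj₂ (proj₂ sp))

        sides : Sides D u A
        sides = proj₂ (proj₂ (proj₂ sp))

        term⁺ : Terminal U u
        term⁺ w w∈ (e , e∈u , e∈w) with w ∈ˢ? D
        ... | yes w∈D = term w w∈D (e , e∈u , e∈w)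
        ... | no w∉D with bridge u∈D w∈ w∉D (inj₁ (e∈u , e∈w))
        -- A conclusion of `u` leaving `D` would be `c` entering `v`, but `c` is a conclusion of
        -- `v`.
        ...   | refl , refl , _ = conc-not-prem c∈v e∈w

        OnLeft⇒t∈A : OnLeft → t ≢ u → t ∈ˢ A
        OnLeft⇒t∈A (inj₁ (t∈A , _)) _   = t∈A
        OnLeft⇒t∈A (inj₂ c∈l)       t≢u =
          ⊥-elim (t≢u (uniqueTgt _ _ _ c∈t (left⊆prems (node ρ u) c∈l)))

        sep⁺ : Separates U u A⁺
        sep⁺ x y x∈U y∈U x≢u y≢u x∈A⁺ y∉A⁺ e l with ∈-comprehension⁻ inA⁺? x∈A⁺ | y ∈ˢ? D
        ... | inj₁ (x∈D , x∈A) | yes y∈D =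
          sep x y x∈D y∈D x≢u y≢u x∈A
            (λ y∈A → y∉A⁺ (∈-comprehension⁺ inA⁺? (inj₁ (y∈D , y∈A)))) e l
        ... | inj₁ (x∈D , x∈A) | no y∉D with bridge x∈D y∈U y∉D l
        -- The link is `c` at `t`, and the outside of `D` was put on the side of `t`.
        ...   | _ , _ , refl = y∉A⁺ (∈-comprehension⁺ inA⁺? (inj₂ (y∉D , inj₁ (x∈A , x≢u))))
        sep⁺ x y x∈U y∈U x≢u y≢u x∈A⁺ y∉A⁺ e l
            | inj₂ (x∉D , on-left) | no y∉D =
          y∉A⁺ (∈-comprehension⁺ inA⁺? (inj₂ (y∉D , on-left)))
        sep⁺ x y x∈U y∈U x≢u y≢u x∈A⁺ y∉A⁺ e l
            | inj₂ (x∉D , on-left) | yes y∈D with bridge y∈D x∈U x∉D (link-sym l)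
        ...   | _ , _ , refl =
          y∉A⁺ (∈-comprehension⁺ inA⁺? (inj₁ (y∈D , OnLeft⇒t∈A on-left y≢u)))

        sideˡ : ∀ {x e} → x ∈ˢ U → e ∈ concs (node ρ x) → e ∈ left (node ρ u) → InA⁺ x
        sideˡ {x} {e} x∈U e∈x e∈l with x ∈ˢ? D
        ... | yes x∈D = inj₁ (x∈D , proj₁ (sides x e x∈D e∈x) e∈l)
        ... | no x∉D with bridge u∈D x∈U x∉D (inj₂ (left⊆prems (node ρ u) e∈l , e∈x))
        ...   | _ , refl , _ = inj₂ (x∉D , inj₂ e∈l)

        sideʳ : ∀ {x e} → x ∈ˢ U → e ∈ concs (node ρ x) → e ∈ right (node ρ u) → ¬ InA⁺ x
        sideʳ {x} {e} x∈U e∈x e∈r (inj₁ (x∈D , x∈A)) = proj₂ (sides x e x∈D e∈x) e∈r x∈A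
        sideʳ {x} {e} x∈U e∈x e∈r (inj₂ (x∉D , on-left))
          with bridge u∈D x∈U x∉D (inj₂ (right⊆prems (node ρ u) e∈r , e∈x)) | on-left
        ... | _ , _ , refl | inj₁ (_ , t≢u) = t≢u refl
        ... | _ , refl , _ | inj₂ c∈l       = left∩right (node ρ u) (portsDistinct u) c∈l e∈r

  -- Three well-founded inductions are nested: inclusion of subsets for the part below a ⅋-vertex,
  -- the converse of `◁` to exclude ⅋-vertices, and arcs to arrive at a terminal vertex.
  ¬¬-splits : ∀ U → Acc _⊂_ U → Nonempty U → ¬ (∀ v A → ¬ Splits U v A)
  ¬¬-splits U (acc smaller) (v₀ , v₀∈U) none = no-vertex v₀ (arc-noetherian v₀) v₀∈U
    where
    open Reachability U

    no-par : ∀ v → Acc (flip _◁_) v → v ∈ˢ U → ∀ {c} → ¬ Par v c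
    no-par v (acc above) v∈U {c} pv@(_ , _ , eq) =
      none v ∅ (splits-∅ v∈U not-terminal (cong left eq) (cong right eq))
      where
      return : ∀ {x g} → Reached v c x → Step g x v → g ≡ c
      return = return-only (λ g≢c → par-ok pv g≢c) λ P sP pu f≢c′ nh →
        -- A counterexample to maximality is a ⅋-vertex above `v`, which the induction hypothesis
        -- excludes.
        no-par _ (above (record { parᵥ = pv ; parᵤ = pu ; route = P ; simple = sP
                                ; last≢ = f≢c′ ; no-hit = nh })) (end∈U P) pu

      not-terminal : Terminal U v
      not-terminal t t∈U (e , e∈v , e∈t) = ¬¬-decidable (Reached v c) go
        where
        e≡c : e ≡ c
        e≡c = par-concs pv e∈v

        c∈t : c ∈ prems (node ρ t)
        c∈t = subst (_∈ prems (node ρ t)) e≡c e∈t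

        go : ¬ Decidable (Reached v c)
        -- A target of `c` in `U` makes the part reached through `c` non-empty, and it misses `v`.
        -- Induction splits it, and `Bridge` carries the splitting over to `U`.
        go reached? = ¬¬-splits D (smaller (D⊆U , v , v∈U , v∉D)) (t , t∈D)
          λ u A sp → none u _ (Bridge.extend U D v∉D t∈D (par-conc pv) c∈t D⊆U leave sp)
          where
          D : Subset nV
          D = comprehension reached?

          D⊆U : ∀ {x} → x ∈ˢ D → x ∈ˢ U
          D⊆U = reached∈U ∘ ∈-comprehension⁻ reached?

          v∉D : v ∉ˢ D
          v∉D v∈D = reached≢ (∈-comprehension⁻ reached? v∈D) refl

          t∈D : t ∈ˢ D
          t∈D = ∈-comprehension⁺ reached? (start (inj₁ (par-conc pv , c∈t) , v∈U , t∈U))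

          leave : ∀ {x y e} → x ∈ˢ D → y ∈ˢ U → y ∉ˢ D → Link ρ e x y → y ≡ v × e ≡ c
          leave {x} {y} x∈D y∈U y∉D l with ∈-comprehension⁻ reached? x∈D | y ≟ v
          ... | r | yes refl = refl , return r (l , D⊆U x∈D , y∈U)
          ... | r | no y≢v   =
            ⊥-elim (y∉D (∈-comprehension⁺ reached? (next r (l , D⊆U x∈D , y∈U) y≢v)))

    not-par : ∀ {u c} → u ∈ˢ U → ¬ Par u c
    not-par {u} u∈U = no-par u (◁-noetherian u) u∈U

    -- The vertices reached through `l` form the left side. If the source of `r` were among them,
    -- `r` would be a second way back to `v`, against `return-only`.
    no-binary : ∀ {v l r} → v ∈ˢ U → Terminal U v → left (node ρ v) ≡ [ l ] →
                right (node ρ v) ≡ [ r ] → ⊥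
    no-binary {v} {l} {r} v∈U term l≡ r≡ = ¬¬-decidable (Reached v l) go
      where
      l∈ : l ∈ left (node ρ v)
      l∈ = subst (l ∈_) (sym l≡) (here refl)

      r∈ : r ∈ right (node ρ v)
      r∈ = subst (r ∈_) (sym r≡) (here refl)

      return : ∀ {x g} → Reached v l x → Step g x v → g ≡ l
      return = return-only (λ g≢l → g≢l , λ pv → ⊥-elim (not-par v∈U pv))
                           (λ P _ pu _ _ → not-par (end∈U P) pu)

      go : ¬ Decidable (Reached v l)
      go reached? = none v (comprehension reached?)
        ( v∈U , term
        , (λ x y x∈U y∈U x≢v y≢v x∈ y∉ e lk →
             y∉ (∈-comprehension⁺ reached?
               (next (∈-comprehension⁻ reached? x∈) (lk , x∈U , y∈U) y≢v)))
        , λ x e x∈U e∈x →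
            (λ e∈l → ∈-comprehension⁺ reached?
              (start (left-link e∈x (subst (e ∈_) l≡ e∈l) , v∈U , x∈U))) ,
            (λ e∈r x∈ → left∩right (node ρ v) (portsDistinct v) l∈
              (subst (_∈ right (node ρ v))
                (return (∈-comprehension⁻ reached? x∈)
                  (inj₁ (e∈x , right⊆prems (node ρ v) e∈r) , x∈U , v∈U)) e∈r)) )
        where
        left-link : ∀ {x e} → e ∈ concs (node ρ x) → e ∈ [ l ] → Link ρ l v x
        left-link e∈x (here refl) = inj₂ (left⊆prems (node ρ v) l∈ , e∈x)

    no-terminal : ∀ {v} → v ∈ˢ U → ¬ Terminal U v
    no-terminal {v} v∈U term = by-kind (node ρ v) refl
      where
      by-kind : ∀ n → node ρ v ≡ n → ⊥
      by-kind (axN _ _)     eq = none v ∅ (splits-∅ v∈U term (cong left eq) (cong right eq))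
      by-kind (parN _ _ _)  eq = not-par v∈U (_ , _ , eq)
      by-kind (cutN _ _)    eq = no-binary v∈U term (cong left eq) (cong right eq)
      by-kind (tensN _ _ _) eq = no-binary v∈U term (cong left eq) (cong right eq)

    -- Following arcs from any vertex would go on forever, since no vertex of `U` is terminal.
    no-vertex : ∀ v → Acc (flip (TransClosure (Arc ρ))) v → v ∈ˢ U → ⊥
    no-vertex v (acc below) v∈U =
      no-terminal v∈U λ w w∈U a → no-vertex w (below [ a ]⁺) w∈U

  exists-split : ∀ {U} → Nonempty U → ∃[ v ] ∃[ A ] Splits U v A
  exists-split {U} ne = decidable-stable (any? λ v → anySubset? λ A → splits? U v A)
    λ ¬ex → ¬¬-splits U (⊂-wellFounded U) ne λ v A sp → ¬ex (v , A , sp)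

-- Renaming the edges of a node.

mapNode-∘ : ∀ {A B C : Set} {f : B → C} {g : A → B} {h : A → C} → (∀ x → f (g x) ≡ h x) →
            ∀ n → mapNode f (mapNode g n) ≡ mapNode h n
mapNode-∘ eq (axN a b)     = cong₂ axN (eq a) (eq b)
mapNode-∘ eq (cutN a b)    = cong₂ cutN (eq a) (eq b)
mapNode-∘ eq (tensN l r c) rewrite eq l | eq r | eq c = refl
mapNode-∘ eq (parN l r c)  rewrite eq l | eq r | eq c = refl

mapNode-id : ∀ {A : Set} (n : Node A) → mapNode id n ≡ n
mapNode-id (axN _ _)     = refl
mapNode-id (cutN _ _)    = refl
mapNode-id (tensN _ _ _) = refl
mapNode-id (parN _ _ _)  = refl

prems-mapNode : ∀ {A B : Set} (f : A → B) n {e} → e ∈ prems n → f e ∈ prems (mapNode f n)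
prems-mapNode f (cutN _ _)    (here refl)         = here refl
prems-mapNode f (cutN _ _)    (there (here refl)) = there (here refl)
prems-mapNode f (tensN _ _ _) (here refl)         = here refl
prems-mapNode f (tensN _ _ _) (there (here refl)) = there (here refl)
prems-mapNode f (parN _ _ _)  (here refl)         = here refl
prems-mapNode f (parN _ _ _)  (there (here refl)) = there (here refl)

-- Conclusions of a derivation

data At {E : Set} (e : E) (A : Formula) : ∀ {Γ} → Cs E Γ → Set where
  here  : ∀ {Γ} {es : Cs E Γ} → At e A {A ∷ Γ} (e ∷ es)
  there : ∀ {B Γ e′} {es : Cs E Γ} → At e A es → At e A {B ∷ Γ} (e′ ∷ es)

private variable
  X Y E₁ E₂ : Set
  Γ Δ : List Formula
  A B : Formula

at-map : ∀ (f : E₁ → E₂) {e} {es : Cs E₁ Γ} → At e A es → At (f e) A (mapC f es)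
at-map f here       = here
at-map f (there at) = there (at-map f at)

at-++ˡ : ∀ {e} {es : Cs E₁ Γ} {fs : Cs E₁ Δ} → At e A es → At e A (AllP.++⁺ es fs)
at-++ˡ here       = here
at-++ˡ (there at) = there (at-++ˡ at)

at-++ʳ : ∀ {e} (es : Cs E₁ Γ) {fs : Cs E₁ Δ} → At e A fs → At e A (AllP.++⁺ es fs)
at-++ʳ []       at = at
at-++ʳ (_ ∷ es) at = there (at-++ʳ es at)

at-init-or-last : ∀ Γ {e} (es : Cs E₁ (Γ ∷ʳ B)) → At e A es → At e A (initC Γ es) ⊎ e ≡ lastC Γ es
at-init-or-last []      (_ ∷ []) here       = inj₂ refl
at-init-or-last (_ ∷ Γ) (_ ∷ es) here       = inj₁ here
at-init-or-last (_ ∷ Γ) (_ ∷ es) (there at) with at-init-or-last Γ es at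
... | inj₁ at′ = inj₁ (there at′)
... | inj₂ eq  = inj₂ eq

at-resp-↭ : ∀ (σ : Γ ↭ Δ) {e} {es : Cs E₁ Γ} → At e A es → At e A (All-resp-↭ σ es)
at-resp-↭ refl↭                      at                 = at
at-resp-↭ (prep _ σ)                 here               = here
at-resp-↭ (prep _ σ)                 (there at)         = there (at-resp-↭ σ at)
at-resp-↭ (swap _ _ σ) {es = _ ∷ _ ∷ _} here            = there here
at-resp-↭ (swap _ _ σ)               (there here)       = here
at-resp-↭ (swap _ _ σ)               (there (there at)) = there (there (at-resp-↭ σ at))
at-resp-↭ (trans↭ σ τ)               at                 = at-resp-↭ τ (at-resp-↭ σ at)

-- Defined by recursion on `Γ` so that `All-resp-↭` computes along it in the two lemmas below.
rotate : ∀ Γ → A ∷ Γ ↭ Γ ∷ʳ A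
rotate         []      = refl↭
rotate {A = A} (B ∷ Γ) = trans↭ (swap A B refl↭) (prep B (rotate Γ))

rotate-last : ∀ Γ {e} (es : Cs E₁ Γ) → lastC Γ {A} (All-resp-↭ (rotate Γ) (e ∷ es)) ≡ e
rotate-last []      []       = refl
rotate-last (_ ∷ Γ) (_ ∷ es) = rotate-last Γ es

rotate-init : ∀ Γ {e} (es : Cs E₁ Γ) → initC Γ {A} (All-resp-↭ (rotate Γ) (e ∷ es)) ≡ es
rotate-init []      []       = refl
rotate-init (_ ∷ Γ) (f ∷ es) = cong (f ∷_) (rotate-init Γ es)

move-last : ∀ {e} (es : Cs E₁ Γ) → At e A es →
            ∃[ Δ ] Σ (Γ ↭ Δ ∷ʳ A) λ σ → lastC Δ (All-resp-↭ σ es) ≡ e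
move-last {Γ = _ ∷ Γ} (_ ∷ es) here       = Γ , rotate Γ , rotate-last Γ es
move-last {Γ = B ∷ _} (_ ∷ es) (there at) with move-last es at
... | Δ , σ , eq = B ∷ Δ , prep B σ , eq

-- For the ⅋ rule, whose principal formulas are the last two: the left one is already last, so the
-- right one only has to move behind it.
move-last-two : ∀ Γ {e} (es : Cs E₁ (Γ ∷ʳ A)) → At e B (initC Γ es) →
                ∃[ Δ ] Σ (Γ ∷ʳ A ↭ (Δ ∷ʳ A) ∷ʳ B) λ σ →
                  lastC Δ (initC (Δ ∷ʳ A) (All-resp-↭ σ es)) ≡ lastC Γ es ×
                  lastC (Δ ∷ʳ A) (All-resp-↭ σ es) ≡ e
move-last-two {A = A} (_ ∷ Γ) (_ ∷ es) here =
  Γ , rotate (Γ ∷ʳ A) , cong (lastC Γ) (rotate-init (Γ ∷ʳ A) es) , rotate-last (Γ ∷ʳ A) es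
move-last-two (C ∷ Γ) (_ ∷ es) (there at) with move-last-two Γ es at
... | Δ , σ , eq , eq′ = C ∷ Δ , prep C σ , eq , eq′

-- A rule turns the conclusions that it consumes into premises of its new vertex and passes on all
-- others.
prem-or-conclusion : (π : Deriv Γ) (e : DE π) →
  (∃[ x ] (e ∈ prems (node (DS π) x))) ⊎ At e (form (DS π) e) (Dc π)
prem-or-conclusion (ax A) false = inj₂ here
prem-or-conclusion (ax A) true  = inj₂ (there here)
prem-or-conclusion (cut {Γ} {Δ} π₁ π₂) (inj₁ e) with prem-or-conclusion π₁ e
... | inj₁ (x , e∈) = inj₁ (inj₁ (inj₁ x) , prems-mapNode _ (node (DS π₁) x) e∈)
... | inj₂ at with at-init-or-last Γ (Dc π₁) at
...   | inj₁ at′  = inj₂ (at-++ˡ (at-map _ at′))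
...   | inj₂ refl = inj₁ (inj₂ tt , here refl)
prem-or-conclusion (cut {Γ} {Δ} π₁ π₂) (inj₂ e) with prem-or-conclusion π₂ e
... | inj₁ (x , e∈) = inj₁ (inj₁ (inj₂ x) , prems-mapNode _ (node (DS π₂) x) e∈)
... | inj₂ at with at-init-or-last Δ (Dc π₂) at
...   | inj₁ at′  = inj₂ (at-++ʳ (mapC _ (initC Γ (Dc π₁))) (at-map _ at′))
...   | inj₂ refl = inj₁ (inj₂ tt , there (here refl))
prem-or-conclusion (tens {Γ} {Δ} π₁ π₂) (inj₁ (inj₁ e)) with prem-or-conclusion π₁ e
... | inj₁ (x , e∈) = inj₁ (inj₁ (inj₁ x) , prems-mapNode _ (node (DS π₁) x) e∈)
... | inj₂ at with at-init-or-last Γ (Dc π₁) at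
...   | inj₁ at′  = inj₂ (at-++ˡ (at-++ˡ (at-map _ at′)))
...   | inj₂ refl = inj₁ (inj₂ tt , here refl)
prem-or-conclusion (tens {Γ} {Δ} π₁ π₂) (inj₁ (inj₂ e)) with prem-or-conclusion π₂ e
... | inj₁ (x , e∈) = inj₁ (inj₁ (inj₂ x) , prems-mapNode _ (node (DS π₂) x) e∈)
... | inj₂ at with at-init-or-last Δ (Dc π₂) at
...   | inj₁ at′  = inj₂ (at-++ˡ (at-++ʳ (mapC _ (initC Γ (Dc π₁))) (at-map _ at′)))
...   | inj₂ refl = inj₁ (inj₂ tt , there (here refl))
prem-or-conclusion (tens {Γ} {Δ} π₁ π₂) (inj₂ tt) =
  inj₂ (at-++ʳ (AllP.++⁺ (mapC _ (initC Γ (Dc π₁))) (mapC _ (initC Δ (Dc π₂)))) here)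
prem-or-conclusion (par {Γ} {A} π) (inj₁ e) with prem-or-conclusion π e
... | inj₁ (x , e∈) = inj₁ (inj₁ x , prems-mapNode _ (node (DS π) x) e∈)
... | inj₂ at with at-init-or-last (Γ ∷ʳ A) (Dc π) at
...   | inj₂ refl = inj₁ (inj₂ tt , there (here refl))
...   | inj₁ at′ with at-init-or-last Γ (initC (Γ ∷ʳ A) (Dc π)) at′
...     | inj₁ at″  = inj₂ (at-++ˡ (at-map _ at″))
...     | inj₂ refl = inj₁ (inj₂ tt , here refl)
prem-or-conclusion (par π) (inj₂ tt) = inj₂ (at-++ʳ (mapC _ _) here)
prem-or-conclusion (mix2 π₁ π₂) (inj₁ e) with prem-or-conclusion π₁ e
... | inj₁ (x , e∈) = inj₁ (inj₁ x , prems-mapNode _ (node (DS π₁) x) e∈)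
... | inj₂ at       = inj₂ (at-++ˡ (at-map _ at))
prem-or-conclusion (mix2 π₁ π₂) (inj₂ e) with prem-or-conclusion π₂ e
... | inj₁ (x , e∈) = inj₁ (inj₂ x , prems-mapNode _ (node (DS π₂) x) e∈)
... | inj₂ at       = inj₂ (at-++ʳ (mapC _ (Dc π₁)) (at-map _ at))
prem-or-conclusion (hyp A) tt = inj₂ here
prem-or-conclusion (ex σ π) e with prem-or-conclusion π e
... | inj₁ x∈ = inj₁ x∈
... | inj₂ at = inj₂ (at-resp-↭ σ at)

-- Derivations of sub-structures

record Partition (R P Q : X → Set) : Set where
  field
    split    : ∀ {x} → R x → P x ⊎ Q x
    mergeˡ   : ∀ {x} → P x → R x
    mergeʳ   : ∀ {x} → Q x → R x
    disjoint : ∀ {x} → P x → ¬ Q x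

-- A bijection of `X` with the part of `Y` cut out by `P`; no subtype is formed, so distinct proofs
-- of `P y` are harmless.
record Enumerates (f : X → Y) (P : Y → Set) : Set where
  field
    injective : ∀ {x x′} → f x ≡ f x′ → x ≡ x′
    sound     : ∀ x → P (f x)
    complete  : ∀ {y} → P y → ∃[ x ] (f x ≡ y)

enumerates-⊎ : {f : X → E₁} {g : Y → E₁} {P Q R : E₁ → Set} → Enumerates f P → Enumerates g Q →
               Partition R P Q → Enumerates [ f , g ]′ R
enumerates-⊎ {X = X} {Y = Y} {f = f} {g} {Q = Q} ef eg part = record
  { injective = inj _ _
  ; sound     = λ { (inj₁ x) → mergeˡ (F.sound x) ; (inj₂ y) → mergeʳ (G.sound y) }
  ; complete  = λ r → [ (λ p → let x , eq = F.complete p in inj₁ x , eq)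
                      , (λ q → let y , eq = G.complete q in inj₂ y , eq) ]′ (split r)
  }
  where
  open Partition part
  module F = Enumerates ef
  module G = Enumerates eg
  inj : ∀ (x x′ : X ⊎ Y) → [ f , g ]′ x ≡ [ f , g ]′ x′ → x ≡ x′
  inj (inj₁ x) (inj₁ x′) eq = cong inj₁ (F.injective eq)
  inj (inj₂ y) (inj₂ y′) eq = cong inj₂ (G.injective eq)
  inj (inj₁ x) (inj₂ y)  eq = ⊥-elim (disjoint (F.sound x) (subst Q (sym eq) (G.sound y)))
  inj (inj₂ y) (inj₁ x)  eq = ⊥-elim (disjoint (F.sound x) (subst Q eq (G.sound y)))

enumerates-point : {y : Y} → Enumerates (λ (_ : ⊤) → y) (_≡ y)
enumerates-point = record
  { injective = λ _ → refl
  ; sound     = λ _ → refl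
  ; complete  = λ { refl → tt , refl }
  }

enumerates-none : {f : ⊥ → Y} {P : Y → Set} → (∀ {y} → ¬ P y) → Enumerates f P
enumerates-none none = record
  { injective = λ { {()} }
  ; sound     = λ ()
  ; complete  = λ p → ⊥-elim (none p)
  }

partition-∪ : {P Q : X → Set} → (∀ {x} → P x → ¬ Q x) → Partition (λ x → P x ⊎ Q x) P Q
partition-∪ d = record { split = λ r → r ; mergeˡ = inj₁ ; mergeʳ = inj₂ ; disjoint = d }

-- This yields the nesting of `DV` for cut and ⊗: two halves first, then the new vertex.
partition-refine : {P P₁ P₂ Q R : X → Set} → Partition R P Q → Partition P P₁ P₂ →
                   Partition R (λ x → P₁ x ⊎ P₂ x) Q
partition-refine p q = record
  { split    = λ r → [ inj₁ ∘ split q , inj₂ ]′ (split p r)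
  ; mergeˡ   = mergeˡ p ∘ [ mergeˡ q , mergeʳ q ]′
  ; mergeʳ   = mergeʳ p
  ; disjoint = disjoint p ∘ [ mergeˡ q , mergeʳ q ]′
  }
  where open Partition

module _ {n} {P : Fin n → Set} where

  infix 5 _∖_

  outside? : ∀ S → Decidable P → Decidable (λ x → x ∈ˢ S × ¬ P x)
  outside? S P? x = (x ∈ˢ? S) ×-dec ¬? (P? x)

  _∖_ : Subset n → Decidable P → Subset n
  S ∖ P? = comprehension (outside? S P?)

  module _ {S : Subset n} (P? : Decidable P) where

    ∈-∖⁺ : ∀ {x} → x ∈ˢ S → ¬ P x → x ∈ˢ S ∖ P?
    ∈-∖⁺ x∈ ¬p = ∈-comprehension⁺ (outside? S P?) (x∈ , ¬p)

    ∈-∖⁻ : ∀ {x} → x ∈ˢ S ∖ P? → x ∈ˢ S × ¬ P x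
    ∈-∖⁻ = ∈-comprehension⁻ (outside? S P?)

    ∖-⊂ : ∀ {x} → x ∈ˢ S → P x → S ∖ P? ⊂ S
    ∖-⊂ x∈ p = proj₁ ∘ ∈-∖⁻ , _ , x∈ , λ x∈′ → proj₂ (∈-∖⁻ x∈′) p

    partition-∖ : (∀ {x} → P x → x ∈ˢ S) → Partition (_∈ˢ S) (_∈ˢ S ∖ P?) P
    partition-∖ P⊆S = record
      { split    = λ {x} x∈ → by-cases x∈ (P? x)
      ; mergeˡ   = proj₁ ∘ ∈-∖⁻
      ; mergeʳ   = P⊆S
      ; disjoint = proj₂ ∘ ∈-∖⁻
      }
      where
      by-cases : ∀ {x} → x ∈ˢ S → Dec (P x) → x ∈ˢ S ∖ P? ⊎ P x
      by-cases x∈ (yes p) = inj₂ p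
      by-cases x∈ (no ¬p) = inj₁ (∈-∖⁺ x∈ ¬p)

partition-complement : ∀ {n} {P : Fin n → Set} {S} (P? : Decidable P) →
                       Partition (_∈ˢ S) (_∈ˢ S ∖ (¬? ∘ P?)) (_∈ˢ S ∖ P?)
partition-complement {P = P} {S} P? = record
  { split    = λ {x} x∈ → by-cases x∈ (P? x)
  ; mergeˡ   = proj₁ ∘ ∈-∖⁻ (¬? ∘ P?)
  ; mergeʳ   = proj₁ ∘ ∈-∖⁻ P?
  ; disjoint = λ x∈ x∈′ → proj₂ (∈-∖⁻ (¬? ∘ P?) x∈) (proj₂ (∈-∖⁻ P? x∈′))
  }
  where
  by-cases : ∀ {x} → x ∈ˢ S → Dec (P x) → x ∈ˢ S ∖ (¬? ∘ P?) ⊎ x ∈ˢ S ∖ P?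
  by-cases x∈ (yes p) = inj₁ (∈-∖⁺ (¬? ∘ P?) x∈ λ ¬p → ¬p p)
  by-cases x∈ (no ¬p) = inj₂ (∈-∖⁺ P? x∈ ¬p)

-- The rules of the calculus on embedded derivations.

module Embeddings {V E : Set} (ρ : Struct V E) where

  -- An isomorphism of the desequentialization of `π` with the part of `ρ` on `P` and `Q`.
  record Embedding {Γ} (π : Deriv Γ) (P : V → Set) (Q : E → Set) : Set where
    field
      vmap  : DV π → V
      emap  : DE π → E
      venum : Enumerates vmap P
      eenum : Enumerates emap Q
      node-hom : ∀ x → node ρ (vmap x) ≡ mapNode emap (node (DS π) x)
      form-hom : ∀ e → form ρ (emap e) ≡ form (DS π) e

  open Embedding

  Sequentialised : (V → Set) → (E → Set) → Set
  Sequentialised P Q = ∃[ Γ ] Σ (Deriv Γ) λ π → Embedding π P Q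

  private variable
    P P₁ P₂ : V → Set
    Q Q₁ Q₂ : E → Set

  embed-ex : {π : Deriv Γ} (σ : Γ ↭ Δ) → Embedding π P Q → Embedding (ex σ π) P Q
  embed-ex σ m = record
    { vmap = vmap m ; emap = emap m ; venum = venum m ; eenum = eenum m
    ; node-hom = node-hom m ; form-hom = form-hom m }

  embed-hyp : ∀ {e} → Embedding (hyp (form ρ e)) (λ _ → ⊥) (_≡ e)
  embed-hyp {e} = record
    { vmap = λ () ; emap = λ _ → e ; venum = enumerates-none (λ ()) ; eenum = enumerates-point
    ; node-hom = λ () ; form-hom = λ _ → refl }

  embed-mix0 : (∀ {v} → ¬ P v) → (∀ {e} → ¬ Q e) → Embedding mix0 P Q
  embed-mix0 noP noQ = record
    { vmap = λ () ; emap = λ () ; venum = enumerates-none noP ; eenum = enumerates-none noQ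
    ; node-hom = λ () ; form-hom = λ () }

  embed-ax : ∀ {v a b} → node ρ v ≡ axN a b → a ≢ b → form ρ a ≡ (form ρ b) ^⊥ →
             Embedding (ax (form ρ b)) (_≡ v) (λ e → e ≡ a ⊎ e ≡ b)
  embed-ax {v} {a} {b} eq a≢b typ = record
    { vmap = λ _ → v ; emap = λ { false → a ; true → b }
    ; venum = enumerates-point
    ; eenum = record
      { injective = λ { {false} {false} _ → refl ; {true} {true} _ → refl
                      ; {false} {true} a≡b → ⊥-elim (a≢b a≡b)
                      ; {true} {false} b≡a → ⊥-elim (a≢b (sym b≡a)) }
      ; sound     = λ { false → inj₁ refl ; true → inj₂ refl }
      ; complete  = λ { (inj₁ refl) → false , refl ; (inj₂ refl) → true , refl }
      }
    ; node-hom = λ _ → eq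
    ; form-hom = λ { false → typ ; true → refl } }

  node-hom-∘ : {π : Deriv Γ} {F : Set} (m : Embedding π P Q) (f : F → E) (g : DE π → F) →
               (∀ e → f (g e) ≡ emap m e) →
               ∀ x → node ρ (vmap m x) ≡ mapNode f (mapNode g (node (DS π) x))
  node-hom-∘ {π = π} m f g eq x = trans (node-hom m x) (sym (mapNode-∘ eq (node (DS π) x)))

  embed-mix2 : {π₁ : Deriv Γ} {π₂ : Deriv Δ} → Embedding π₁ P₁ Q₁ → Embedding π₂ P₂ Q₂ →
               Partition P P₁ P₂ → Partition Q Q₁ Q₂ → Embedding (mix2 π₁ π₂) P Q
  embed-mix2 m₁ m₂ vpart epart = record
    { vmap  = [ vmap m₁ , vmap m₂ ]′
    ; emap  = [ emap m₁ , emap m₂ ]′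
    ; venum = enumerates-⊎ (venum m₁) (venum m₂) vpart
    ; eenum = enumerates-⊎ (eenum m₁) (eenum m₂) epart
    ; node-hom = λ { (inj₁ x) → node-hom-∘ m₁ _ _ (λ _ → refl) x
                   ; (inj₂ x) → node-hom-∘ m₂ _ _ (λ _ → refl) x }
    ; form-hom = λ { (inj₁ e) → form-hom m₁ e ; (inj₂ e) → form-hom m₂ e }
    }

  -- `A` is kept apart from `form ρ e` so that, for the right premise of a cut, it can be rewritten
  -- into the dual that the rule expects.
  record Ending (A : Formula) (e : E) (P : V → Set) (Q : E → Set) : Set where
    field
      {context} : List Formula
      deriv     : Deriv (context ∷ʳ A)
      embedding : Embedding deriv P Q
      ends      : emap embedding (lastC context (Dc deriv)) ≡ e

  -- Were the preimage of `e` a premise in `π`, its image would be a premise of a vertex in `P`.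
  conclusion-at : {π : Deriv Γ} (m : Embedding π P Q) → ∀ {e} → Q e →
                  (∀ {v} → P v → e ∉ prems (node ρ v)) →
                  ∃[ d ] (emap m d ≡ e × At d (form ρ e) (Dc π))
  conclusion-at {π = π} m q free with Enumerates.complete (eenum m) q
  ... | d , refl with prem-or-conclusion π d
  ...   | inj₂ at = d , refl , subst (λ A → At d A (Dc π)) (sym (form-hom m d)) at
  ...   | inj₁ (x , d∈) = ⊥-elim (free (Enumerates.sound (venum m) x)
            (subst (λ n → _ ∈ prems n) (sym (node-hom m x)) (prems-mapNode _ (node (DS π) x) d∈)))

  to-end : ∀ {e} → Sequentialised P Q → Q e → (∀ {v} → P v → e ∉ prems (node ρ v)) →
           Ending (form ρ e) e P Q
  to-end (Γ , π , m) q free with conclusion-at m q free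
  ... | d , eq , at with move-last (Dc π) at
  ...   | Δ , σ , last≡ = record
    { deriv = ex σ π ; embedding = embed-ex σ m ; ends = trans (cong (emap m) last≡) eq }

  sequentialised-cut : ∀ {v l r} → node ρ v ≡ cutN l r → form ρ r ≡ (form ρ l) ^⊥ →
    Ending (form ρ l) l P₁ Q₁ → Ending (form ρ r) r P₂ Q₂ → (∀ {x} → P₁ x → ¬ P₂ x) →
    Partition P (λ x → P₁ x ⊎ P₂ x) (_≡ v) → Partition Q Q₁ Q₂ → Sequentialised P Q
  sequentialised-cut {v = v} eq typ ending₁ ending₂ disj vpart epart rewrite typ =
    _ , cut E₁.deriv E₂.deriv , record
      { vmap  = [ [ vmap m₁ , vmap m₂ ]′ , (λ _ → v) ]′
      ; emap  = [ emap m₁ , emap m₂ ]′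
      ; venum = enumerates-⊎ (enumerates-⊎ (venum m₁) (venum m₂) (partition-∪ disj))
                             enumerates-point vpart
      ; eenum = enumerates-⊎ (eenum m₁) (eenum m₂) epart
      ; node-hom = λ { (inj₁ (inj₁ x)) → node-hom-∘ m₁ _ _ (λ _ → refl) x
                     ; (inj₁ (inj₂ x)) → node-hom-∘ m₂ _ _ (λ _ → refl) x
                     ; (inj₂ tt) → trans eq (cong₂ cutN (sym E₁.ends) (sym E₂.ends)) }
      ; form-hom = λ { (inj₁ e) → form-hom m₁ e ; (inj₂ e) → form-hom m₂ e }
      }
    where
    module E₁ = Ending ending₁
    module E₂ = Ending ending₂
    m₁ = E₁.embedding
    m₂ = E₂.embedding

  sequentialised-tens : ∀ {v l r c} → node ρ v ≡ tensN l r c → form ρ c ≡ form ρ l ⊗ form ρ r →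
    Ending (form ρ l) l P₁ Q₁ → Ending (form ρ r) r P₂ Q₂ →
    (∀ {x} → P₁ x → ¬ P₂ x) → Partition P (λ x → P₁ x ⊎ P₂ x) (_≡ v) →
    (∀ {e} → Q₁ e → ¬ Q₂ e) → Partition Q (λ e → Q₁ e ⊎ Q₂ e) (_≡ c) → Sequentialised P Q
  sequentialised-tens {v = v} {c = c} eq typ ending₁ ending₂ vdisj vpart edisj epart =
    _ , tens E₁.deriv E₂.deriv , record
      { vmap  = [ [ vmap m₁ , vmap m₂ ]′ , (λ _ → v) ]′
      ; emap  = [ [ emap m₁ , emap m₂ ]′ , (λ _ → c) ]′
      ; venum = enumerates-⊎ (enumerates-⊎ (venum m₁) (venum m₂) (partition-∪ vdisj))
                             enumerates-point vpart
      ; eenum = enumerates-⊎ (enumerates-⊎ (eenum m₁) (eenum m₂) (partition-∪ edisj))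
                             enumerates-point epart
      ; node-hom = λ { (inj₁ (inj₁ x)) → node-hom-∘ m₁ _ _ (λ _ → refl) x
                     ; (inj₁ (inj₂ x)) → node-hom-∘ m₂ _ _ (λ _ → refl) x
                     ; (inj₂ tt) → trans eq (cong₂ (λ a b → tensN a b c) (sym E₁.ends) (sym E₂.ends)) }
      ; form-hom = λ { (inj₁ (inj₁ e)) → form-hom m₁ e ; (inj₁ (inj₂ e)) → form-hom m₂ e
                     ; (inj₂ tt) → typ }
      }
    where
    module E₁ = Ending ending₁
    module E₂ = Ending ending₂
    m₁ = E₁.embedding
    m₂ = E₂.embedding

  sequentialised-par : ∀ {v l r c} → node ρ v ≡ parN l r c → form ρ c ≡ form ρ l ⅋ form ρ r →
    l ≢ r → Ending (form ρ l) l P₁ Q₁ → Q₁ r → (∀ {x} → P₁ x → r ∉ prems (node ρ x)) →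
    Partition P P₁ (_≡ v) → Partition Q Q₁ (_≡ c) → Sequentialised P Q
  sequentialised-par {v = v} {c = c} eq typ l≢r ending q free vpart epart
    with conclusion-at (Ending.embedding ending) q free
  ... | d , d↦r , at with at-init-or-last (Ending.context ending) (Dc (Ending.deriv ending)) at
  -- The last conclusion is sent to `l`, so `r` comes from one of the others.
  ...   | inj₂ refl = ⊥-elim (l≢r (trans (sym (Ending.ends ending)) d↦r))
  ...   | inj₁ at′ with move-last-two (Ending.context ending) (Dc (Ending.deriv ending)) at′
  ...     | Δ , σ , l≡ , r≡ = _ , par (ex σ (Ending.deriv ending)) , record
      { vmap  = [ vmap m , (λ _ → v) ]′
      ; emap  = [ emap m , (λ _ → c) ]′
      ; venum = enumerates-⊎ (venum m) enumerates-point vpart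
      ; eenum = enumerates-⊎ (eenum m) enumerates-point epart
      ; node-hom = λ { (inj₁ x) → node-hom-∘ m _ _ (λ _ → refl) x
                     ; (inj₂ tt) → trans eq (cong₂ (λ a b → parN a b c)
                         (sym (trans (cong (emap m) l≡) (Ending.ends ending)))
                         (sym (trans (cong (emap m) r≡) d↦r))) }
      ; form-hom = λ { (inj₁ e) → form-hom m e ; (inj₂ tt) → typ }
      }
    where
    m = Ending.embedding ending

  embedding⇒≅ : {π : Deriv Γ} → Embedding π P Q → (∀ v → P v) → (∀ e → Q e) → ρ ≅ DS π
  embedding⇒≅ {π = π} m allP allQ = record
    { vIso    = mk↔ₛ′ to-v (vmap m)
                  (λ x → VE.injective (proj₂ (VE.complete (allP (vmap m x)))))
                  (λ v → proj₂ (VE.complete (allP v)))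
    ; eIso    = mk↔ₛ′ to-e (emap m) to-e∘emap (λ e → proj₂ (EE.complete (allQ e)))
    ; nodeHom = λ v → sym (nodes v)
    ; formHom = λ e → trans (sym (form-hom m (to-e e))) (cong (form ρ) (proj₂ (EE.complete (allQ e))))
    }
    where
    module VE = Enumerates (venum m)
    module EE = Enumerates (eenum m)

    to-v : V → DV π
    to-v v = proj₁ (VE.complete (allP v))

    to-e : E → DE π
    to-e e = proj₁ (EE.complete (allQ e))

    to-e∘emap : ∀ d → to-e (emap m d) ≡ d
    to-e∘emap d = EE.injective (proj₂ (EE.complete (allQ (emap m d))))

    nodes : ∀ v → mapNode to-e (node ρ v) ≡ node (DS π) (to-v v)
    nodes v = trans
      (cong (mapNode to-e)
        (trans (cong (node ρ) (sym (proj₂ (VE.complete (allP v))))) (node-hom m (to-v v))))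
      (trans (mapNode-∘ to-e∘emap (node (DS π) (to-v v))) (mapNode-id (node (DS π) (to-v v))))


-- Induction on sub-nets.

module Sequentialisation {nV nE : ℕ} (ρ : Struct (Fin nV) (Fin nE)) (net : IsProofNet ρ) where

  open IsProofNet net
  open IsProofStructure isPS
  open Structure ρ isPS
  open Splitting ρ net
  open Embeddings ρ
  open DecMembership (_≟_ {nE}) using (_∈?_)

  -- W and F are the vertices and edges of a sub-net of ρ.
  Closed : Subset nV → Subset nE → Set
  Closed W F = ∀ {v e} → v ∈ˢ W → Inc e v → e ∈ˢ F

  SequentialisedSubset : Subset nV → Subset nE → Set
  SequentialisedSubset W F = Sequentialised (_∈ˢ W) (_∈ˢ F)

  inc? : ∀ e v → Dec (Inc e v)
  inc? e v = (e ∈? concs (node ρ v)) ⊎-dec (e ∈? prems (node ρ v))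

  inc-link : ∀ {e x y} → Inc e x → Inc e y → x ≡ y ⊎ Link ρ e x y
  inc-link (inj₁ cx) (inj₁ cy) = inj₁ (uniqueSrc _ _ _ cx cy)
  inc-link (inj₁ cx) (inj₂ py) = inj₂ (inj₁ (cx , py))
  inc-link (inj₂ px) (inj₁ cy) = inj₂ (inj₂ (px , cy))
  inc-link (inj₂ px) (inj₂ py) = inj₁ (uniqueTgt _ _ _ px py)

  terminal-conc : ∀ {W v x e} → Terminal W v → e ∈ concs (node ρ v) → x ∈ˢ W → Inc e x → x ≡ v
  terminal-conc term c x∈ (inj₁ cx) = uniqueSrc _ _ _ cx c
  terminal-conc term c x∈ (inj₂ px) = ⊥-elim (term _ x∈ (_ , c , px))

  -- Without vertices only bare edges are left: one `hyp` for each, joined by `mix2` starting from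
  -- `mix0`.
  hypotheses : ∀ {P} → (∀ {v} → ¬ P v) → ∀ F → Acc _⊂_ F → Sequentialised P (_∈ˢ F)
  hypotheses none F (acc smaller) with nonempty? F
  ... | no empty = _ , mix0 , embed-mix0 none (λ e∈ → empty (_ , e∈))
  ... | yes (e , e∈) with hypotheses none (F ∖ (_≟ e)) (smaller (∖-⊂ (_≟ e) e∈ refl))
  ...   | _ , π , m = _ , mix2 π (hyp (form ρ e)) ,
    embed-mix2 m embed-hyp
      (record { split = inj₁ ; mergeˡ = id ; mergeʳ = λ () ; disjoint = λ _ () })
      (partition-∖ (_≟ e) λ { refl → e∈ })

  module Step {W F} (closed : Closed W F) {v A} (splits : Splits W v A)
    (smaller : ∀ {W′ F′} → Closed W′ F′ → W′ ⊂ W → SequentialisedSubset W′ F′)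
    where

    v∈W : v ∈ˢ W
    v∈W = proj₁ splits

    terminal : Terminal W v
    terminal = proj₁ (proj₂ splits)

    separates : Separates W v A
    separates = proj₁ (proj₂ (proj₂ splits))

    sides : Sides W v A
    sides = proj₂ (proj₂ (proj₂ splits))

    W₀ : Subset nV
    W₀ = W ∖ (_≟ v)

    W₀⊂W : W₀ ⊂ W
    W₀⊂W = ∖-⊂ (_≟ v) v∈W refl

    W-partition : Partition (_∈ˢ W) (_∈ˢ W₀) (_≡ v)
    W-partition = partition-∖ (_≟ v) λ { refl → v∈W }

    ∈W₀⁻ : ∀ {x} → x ∈ˢ W₀ → x ∈ˢ W × x ≢ v
    ∈W₀⁻ = ∈-∖⁻ (_≟ v)

    not-prem : ∀ {e x} → e ∈ prems (node ρ v) → x ∈ˢ W₀ → e ∉ prems (node ρ x)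
    not-prem e∈v x∈ e∈x = proj₂ (∈W₀⁻ x∈) (uniqueTgt _ _ _ e∈x e∈v)

    -- The conclusions of a terminal vertex touch no other vertex of `W`, so they can be removed
    -- along with it.
    closed-∖ : ∀ {P : E → Set} (P? : Decidable P) → (∀ {e} → P e → e ∈ concs (node ρ v)) →
               Closed W₀ (F ∖ P?)
    closed-∖ P? P⊆concs x∈ i with ∈W₀⁻ x∈
    ... | x∈W , x≢v =
      ∈-∖⁺ P? (closed x∈W i) (λ p → x≢v (terminal-conc terminal (P⊆concs p) x∈W i))

    -- Shared by cut and ⊗: `F₀` is `F` for a cut, and `F` without the new conclusion for a ⊗.
    module Halves {F₀ l r} (closed₀ : Closed W₀ F₀) (l∈F₀ : l ∈ˢ F₀) (r∈F₀ : r ∈ˢ F₀)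
      (l∈ : l ∈ left (node ρ v)) (r∈ : r ∈ right (node ρ v)) where

      inA? : Decidable (_∈ˢ A)
      inA? = _∈ˢ? A

      W₁ W₂ : Subset nV
      W₁ = W₀ ∖ (¬? ∘ inA?)
      W₂ = W₀ ∖ inA?

      -- The premise l may have no source in W, hence the second case.
      InF₁ : E → Set
      InF₁ e = (∃[ x ] (x ∈ˢ W₁ × Inc e x)) ⊎ e ≡ l

      inF₁? : Decidable InF₁
      inF₁? e = (any? λ x → (x ∈ˢ? W₁) ×-dec inc? e x) ⊎-dec (e ≟ l)

      F₁ F₂ : Subset nE
      F₁ = F₀ ∖ (¬? ∘ inF₁?)
      F₂ = F₀ ∖ inF₁?

      ∈W₁⁻ : ∀ {x} → x ∈ˢ W₁ → x ∈ˢ W₀ × x ∈ˢ A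
      ∈W₁⁻ {x} x∈ with ∈-∖⁻ (¬? ∘ inA?) x∈
      ... | x∈W₀ , ¬¬x∈A = x∈W₀ , decidable-stable (inA? x) ¬¬x∈A

      ∈F₁⁺ : ∀ {e} → e ∈ˢ F₀ → InF₁ e → e ∈ˢ F₁
      ∈F₁⁺ e∈ p = ∈-∖⁺ (¬? ∘ inF₁?) e∈ (λ ¬p → ¬p p)

      closed₁ : Closed W₁ F₁
      closed₁ x∈ i = ∈F₁⁺ (closed₀ (proj₁ (∈W₁⁻ x∈)) i) (inj₁ (_ , x∈ , i))

      -- An edge at a vertex outside `A` is not `l`, whose source would be in `A` and whose target
      -- is `v`; nor does it touch `W₁`, by separation.
      closed₂ : Closed W₂ F₂
      closed₂ {x} {e} x∈ i with ∈-∖⁻ inA? x∈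
      ... | x∈W₀ , x∉A = ∈-∖⁺ inF₁? (closed₀ x∈W₀ i) (not-in-F₁ i)
        where
        x∈W : x ∈ˢ W
        x∈W = proj₁ (∈W₀⁻ x∈W₀)

        not-in-F₁ : Inc e x → ¬ InF₁ e
        not-in-F₁ (inj₁ e∈c) (inj₂ refl) = x∉A (proj₁ (sides x e x∈W e∈c) l∈)
        not-in-F₁ (inj₂ e∈p) (inj₂ refl) = not-prem (left⊆prems (node ρ v) l∈) x∈W₀ e∈p
        not-in-F₁ i (inj₁ (y , y∈ , j)) with ∈W₁⁻ y∈ | inc-link j i
        ... | y∈W₀ , y∈A | inj₁ refl = x∉A y∈A
        ... | y∈W₀ , y∈A | inj₂ lk   =
          separates y x (proj₁ (∈W₀⁻ y∈W₀)) x∈W (proj₂ (∈W₀⁻ y∈W₀)) (proj₂ (∈W₀⁻ x∈W₀)) y∈A x∉A e lk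

      r∈F₂ : r ∈ˢ F₂
      r∈F₂ = ∈-∖⁺ inF₁? r∈F₀ λ where
        (inj₂ refl) → left∩right (node ρ v) (portsDistinct v) l∈ r∈
        (inj₁ (x , x∈ , inj₁ r∈c)) →
          proj₂ (sides x r (proj₁ (∈W₀⁻ (proj₁ (∈W₁⁻ x∈)))) r∈c) r∈ (proj₂ (∈W₁⁻ x∈))
        (inj₁ (x , x∈ , inj₂ r∈p)) →
          not-prem (right⊆prems (node ρ v) r∈) (proj₁ (∈W₁⁻ x∈)) r∈p

      ∖-⊂-W : ∀ {P : V → Set} (P? : Decidable P) → (W₀ ∖ P?) ⊂ W
      ∖-⊂-W P? = (λ x∈ → proj₁ (∈W₀⁻ (proj₁ (∈-∖⁻ P? x∈)))) ,
                 v , v∈W , λ v∈ → proj₂ (∈W₀⁻ (proj₁ (∈-∖⁻ P? v∈))) refl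

      ending₁ : Ending (form ρ l) l (_∈ˢ W₁) (_∈ˢ F₁)
      ending₁ = to-end (smaller closed₁ (∖-⊂-W (¬? ∘ inA?))) (∈F₁⁺ l∈F₀ (inj₂ refl))
        λ x∈ → not-prem (left⊆prems (node ρ v) l∈) (proj₁ (∈W₁⁻ x∈))

      ending₂ : Ending (form ρ r) r (_∈ˢ W₂) (_∈ˢ F₂)
      ending₂ = to-end (smaller closed₂ (∖-⊂-W inA?)) r∈F₂
        λ x∈ → not-prem (right⊆prems (node ρ v) r∈) (proj₁ (∈-∖⁻ inA? x∈))

      W₀-partition : Partition (_∈ˢ W₀) (_∈ˢ W₁) (_∈ˢ W₂)
      W₀-partition = partition-complement inA?

      F₀-partition : Partition (_∈ˢ F₀) (_∈ˢ F₁) (_∈ˢ F₂)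
      F₀-partition = partition-complement inF₁?

    prem∈F : ∀ {e} → e ∈ prems (node ρ v) → e ∈ˢ F
    prem∈F = closed v∈W ∘ inj₂

    typing : ∀ {n} → node ρ v ≡ n → WellTyped ρ n
    typing eq = subst (WellTyped ρ) eq (typed v)

    ports-distinct : ∀ {n} → node ρ v ≡ n → Unique (concs n ++ prems n)
    ports-distinct eq = subst (λ n → Unique (concs n ++ prems n)) eq (portsDistinct v)

    conc⁺ : ∀ {n e} → node ρ v ≡ n → e ∈ concs n → e ∈ concs (node ρ v)
    conc⁺ eq = subst (λ n → _ ∈ concs n) (sym eq)

    prem⁺ : ∀ {n e} → node ρ v ≡ n → e ∈ prems n → e ∈ prems (node ρ v)
    prem⁺ eq = subst (λ n → _ ∈ prems n) (sym eq)

    by-kind : ∀ n → node ρ v ≡ n → SequentialisedSubset W F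
    -- A terminal ax-vertex is disconnected from the rest, so `mix2` adds it.
    by-kind (axN a b) eq =
      let _ , π , m = smaller (closed-∖ ab? ab⊆concs) W₀⊂W
      in _ , mix2 π (ax (form ρ b)) ,
         embed-mix2 m (embed-ax eq (a≢b (ports-distinct eq)) (typing eq)) W-partition
           (partition-∖ ab? (closed v∈W ∘ inj₁ ∘ ab⊆concs))
      where
      ab? : Decidable λ e → e ≡ a ⊎ e ≡ b
      ab? e = (e ≟ a) ⊎-dec (e ≟ b)

      ab⊆concs : ∀ {e} → e ≡ a ⊎ e ≡ b → e ∈ concs (node ρ v)
      ab⊆concs (inj₁ refl) = conc⁺ eq (here refl)
      ab⊆concs (inj₂ refl) = conc⁺ eq (there (here refl))

      a≢b : Unique (a ∷ b ∷ []) → a ≢ b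
      a≢b ((a≢b ∷ []) ∷ _) = a≢b
    by-kind (parN l r c) eq with ports-distinct eq
    ... | (c≢l ∷ c≢r ∷ []) ∷ (l≢r ∷ []) ∷ _ =
      sequentialised-par eq (typing eq) l≢r
        (to-end (smaller (closed-∖ (_≟ c) c-conc) W₀⊂W)
          (∈-∖⁺ (_≟ c) (prem∈F l∈) (c≢l ∘ sym)) (not-prem l∈))
        (∈-∖⁺ (_≟ c) (prem∈F r∈) (c≢r ∘ sym)) (not-prem r∈)
        W-partition (partition-∖ (_≟ c) λ { refl → closed v∈W (inj₁ (c-conc refl)) })
      where
      c-conc : ∀ {e} → e ≡ c → e ∈ concs (node ρ v)
      c-conc refl = conc⁺ eq (here refl)
      l∈ = prem⁺ eq (here refl)
      r∈ = prem⁺ eq (there (here refl))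
    by-kind (cutN l r) eq =
      sequentialised-cut eq (typing eq) H.ending₁ H.ending₂ (Partition.disjoint H.W₀-partition)
        (partition-refine W-partition H.W₀-partition) H.F₀-partition
      where
      module H = Halves {F} (λ x∈ → closed (proj₁ (∈W₀⁻ x∈)))
        (prem∈F (prem⁺ eq (here refl))) (prem∈F (prem⁺ eq (there (here refl))))
        (subst (λ n → l ∈ left n) (sym eq) (here refl))
        (subst (λ n → r ∈ right n) (sym eq) (here refl))
    by-kind (tensN l r c) eq with ports-distinct eq
    ... | (c≢l ∷ c≢r ∷ []) ∷ _ =
      sequentialised-tens eq (typing eq) H.ending₁ H.ending₂ (Partition.disjoint H.W₀-partition)
        (partition-refine W-partition H.W₀-partition) (Partition.disjoint H.F₀-partition)
        (partition-refine (partition-∖ (_≟ c) λ { refl → closed v∈W (inj₁ (c-conc refl)) })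
                          H.F₀-partition)
      where
      c-conc : ∀ {e} → e ≡ c → e ∈ concs (node ρ v)
      c-conc refl = conc⁺ eq (here refl)
      module H = Halves (closed-∖ (_≟ c) c-conc)
        (∈-∖⁺ (_≟ c) (prem∈F (prem⁺ eq (here refl))) (c≢l ∘ sym))
        (∈-∖⁺ (_≟ c) (prem∈F (prem⁺ eq (there (here refl)))) (c≢r ∘ sym))
        (subst (λ n → l ∈ left n) (sym eq) (here refl))
        (subst (λ n → r ∈ right n) (sym eq) (here refl))

  -- The induction is on `W` alone; once `W` is empty, `hypotheses` uses up the edges left in `F`.
  sequentialise : ∀ W F → Acc _⊂_ W → Closed W F → SequentialisedSubset W F
  sequentialise W F (acc smaller) closed with nonempty? W
  ... | yes ne with exists-split ne
  ...   | v , A , splits =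
    Step.by-kind closed splits (λ cl W′⊂W → sequentialise _ _ (smaller W′⊂W) cl) (node ρ v) refl
  sequentialise W F (acc smaller) closed | no empty =
    hypotheses (λ x∈ → empty (_ , x∈)) F (⊂-wellFounded F)

  sequentialisation : ∃[ Γ ] Σ (Deriv Γ) (λ π → ρ ≅ DS π)
  sequentialisation with sequentialise full full (⊂-wellFounded full) (λ _ _ → ∈⊤)
  ... | Γ , π , m = Γ , π , embedding⇒≅ m (λ _ → ∈⊤) (λ _ → ∈⊤)

theorem6p1 : (nV nE : ℕ) (ρ : Struct (Fin nV) (Fin nE)) → IsProofNet ρ →
    ∃[ Γ ] Σ (Deriv Γ) (λ π → ρ ≅ DS π)
theorem6p1 nV nE ρ net = Sequentialisation.sequentialisation ρ net
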